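{- Let $n\ge3$, $1\le m\le n-1$, and let $P\subset SL_n(\mathbb C)$ be the maximal parabolic subgroup corresponding to $I_P=\{1,\dots,n-1\}\setminus\{m\}$. Then $$\pi_P(t_{ -\theta})=s_ms_{m+1}\cdots s_{n-1}\,s_{m-1}s_{m-2}\cdots s_1s_0 .$$
   Context: $\tilde S_n$ ($n\ge3$) is the affine symmetric group, generated by $s_0,\dots,s_{n-1}$ (indices mod $n$) with $s_i^2=1$, $s_is_{i+1}s_i=s_{i+1}s_is_{i+1}$, and $s_is_j=s_js_i$ if $i-j\not\equiv\pm1$; $S_n=\langle s_1,\dots,s_{n-1}\rangle$. Roots: $\alpha_i=\vec e_i-\vec e_{i+1}\in\mathbb R^n$ ($1\le i\le n-1$), $R=\{\vec e_i-\vec e_j:i\ne j\}$, $R^+=\{\vec e_i-\vec e_j:i<j\}$, $Q=\mathbb ZR$, highest root $\theta=\vec e_1-\vec e_n$. Translations: $\tilde S_n$ acts faithfully on the hyperplane $V=\mathrm{span}(R)\subset\mathbb R^n$ by affine maps, with $s_i$ ($1\le i\le n-1$) exchanging coordinates $i,i+1$ and $s_0(c_1,\dots,c_n)=(c_n+1,c_2,\dots,c_{n-1},c_1-1)$. For $\lambda\in Q$, $t_\lambda\in\tilde S_n$ is the element acting as translation by $\lambda$; $\tilde S_n=S_n\ltimes\{t_\lambda:\lambda\in Q\}$. Affine roots: $\delta=\alpha_0+\theta$ (with $\alpha_0$ a formal extra root), $R_{af}=\{\alpha+p\delta:\alpha\in R,p\in\mathbb Z\}$, $R_{af}^+=\{\alpha+p\delta:\alpha\in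 R,p>0\}\cup R^+$. The level-zero action of $\tilde S_n$ on $R_{af}$ is linear with $s_j\delta=\delta$, $s_j\alpha_j=-\alpha_j$, $s_j\alpha_i=\alpha_i+\alpha_j$ if $i-j\equiv\pm1\pmod n$, $s_j\alpha_i=\alpha_i$ otherwise. For $I_P=\{1,\dots,n-1\}\setminus\{m\}$: $R_P=\{\vec e_i-\vec e_j:i\ne j,\ 1\le i,j\le m\text{ or }m+1\le i,j\le n\}$, $Q_P=\mathbb ZR_P$, $(S_n)_P=\langle s_i:i\in I_P\rangle\cong S_m\times S_{n-m}$, $(R_P)^+_{af}=\{\alpha+p\delta\in R^+_{af}:\alpha\in R_P\}$, $$\tilde S_n^P=\{w\in\tilde S_n:w\cdot\beta\in R_{af}^+\text{ for all }\beta\in(R_P)^+_{af}\},\qquad(\tilde S_n)_P=\{vt_\lambda:\lambda\in Q_P,\ v\in(S_n)_P\}.$$ Every $w\in\tilde S_n$ has a unique factorization $w=w_1w_2$ with $w_1\in\tilde S_n^P$, $w_2\in(\tilde S_n)_P$, and $\pi_P:\tilde S_n\to\tilde S_n^P$ is defined by $\pi_P(w)=w_1$. -}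

module Defs where

open import Algebra.Bundles using (CommutativeRing)
import Algebra.Properties.Monoid.Mult as Mult
import Algebra.Properties.Monoid.Sum as Sum
open import Data.Bool using (if_then_else_)
open import Data.Fin as Fin using (Fin; zero; suc; toℕ; inject₁)
open import Data.Fin.Permutation.Components using (transpose)
open import Data.Integer as ℤ using (ℤ; +_; -[1+_]; 0ℤ; 1ℤ)
import Data.Integer.Properties as ℤ
open import Data.List using (List; []; _∷_; _++_; foldr; map; upTo; downFrom)
open import Data.List.Relation.Unary.All using (All)
open import Data.Nat as ℕ using (ℕ; zero; suc; NonZero)
open import Data.Nat.DivMod using (_mod_)
open import Data.Product using (_×_; ∃; ∃-syntax)
open import Data.Sum using (_⊎_)
open import Data.Vec.Functional using (Vector; updateAt; replicate; zipWith)
open import Function using (_∘_; const)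
open import Relation.Binary.PropositionalEquality using (_≡_; _≢_; _≗_)
open import Relation.Nullary using (¬_; Dec; does; _⊎-dec_)

-- Fin n plays two roles.  As the index set of the generators sᵢ and of the
-- affine simple roots αᵢ, the element with toℕ i = i stands for i itself
-- (a residue mod n).  As the index set of coordinates c₁, …, cₙ, it is shifted:
-- the coordinate c_k sits at the element with toℕ = k - 1.

------------------------------------------------------------------------
-- The affine symmetric group

next : ∀ {n} .{{_ : NonZero n}} → Fin n → Fin n
next {n} i = suc (toℕ i) mod n

Adjacent : ∀ {n} .{{_ : NonZero n}} → Fin n → Fin n → Set
Adjacent i j = j ≡ next i ⊎ i ≡ next j

adjacent? : ∀ {n} .{{_ : NonZero n}} (i j : Fin n) → Dec (Adjacent i j)
adjacent? i j = (j Fin.≟ next i) ⊎-dec (i Fin.≟ next j)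

-- An element of the group is a word in the generators, taken up to _≈_ below;
-- the product is _++_.  No formal inverses are needed, as each generator is
-- its own inverse.
Word : ℕ → Set
Word n = List (Fin n)

infix 4 _≈_
data _≈_ {n} .{{_ : NonZero n}} : Word n → Word n → Set where
  refl   : ∀ {u} → u ≈ u
  sym    : ∀ {u v} → u ≈ v → v ≈ u
  trans  : ∀ {u v w} → u ≈ v → v ≈ w → u ≈ w
  ++-cong : ∀ {u u′ v v′} → u ≈ u′ → v ≈ v′ → u ++ v ≈ u′ ++ v′
  square : ∀ i → i ∷ i ∷ [] ≈ []
  braid  : ∀ i → i ∷ next i ∷ i ∷ [] ≈ next i ∷ i ∷ next i ∷ []
  commute : ∀ i j → ¬ Adjacent i j → i ∷ j ∷ [] ≈ j ∷ i ∷ []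

------------------------------------------------------------------------
-- Finite roots

infixl 6 _⊕_ _⊖_
_⊕_ _⊖_ : ∀ {n} → Vector ℤ n → Vector ℤ n → Vector ℤ n
_⊕_ = zipWith ℤ._+_
_⊖_ = zipWith ℤ._-_

infix 8 ⊝_
⊝_ : ∀ {n} → Vector ℤ n → Vector ℤ n
⊝ x = ℤ.-_ ∘ x

e : ∀ {n} → Fin n → Vector ℤ n
e i k = if does (i Fin.≟ k) then 1ℤ else 0ℤ

firstIx lastIx : ∀ {n} .{{_ : NonZero n}} → Fin n
firstIx {n} = 0 mod n
lastIx {n} = ℕ.pred n mod n

θ : ∀ {n} .{{_ : NonZero n}} → Vector ℤ n
θ = e firstIx ⊖ e lastIx

-- For i ≠ j: e i ⊖ e j lies in R_P, where I_P omits m.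
SameBlock : ∀ {n} → ℕ → Fin n → Fin n → Set
SameBlock m i j = (toℕ i ℕ.< m × toℕ j ℕ.< m) ⊎ (m ℕ.≤ toℕ i × m ℕ.≤ toℕ j)

-- Q_P = ℤ R_P
data InQₚ {n} (m : ℕ) : Vector ℤ n → Set where
  root : ∀ {i j} → i ≢ j → SameBlock m i j → InQₚ m (e i ⊖ e j)
  zero : InQₚ m (replicate n 0ℤ)
  add  : ∀ {x y} → InQₚ m x → InQₚ m y → InQₚ m (x ⊕ y)
  neg  : ∀ {x} → InQₚ m x → InQₚ m (⊝ x)
  resp : ∀ {x y} → x ≗ y → InQₚ m x → InQₚ m y

------------------------------------------------------------------------
-- The affine action and translations

-- Scalars: agda-stdlib has no real numbers, so the coordinate field is an
-- arbitrary commutative ring of characteristic zero; ℝ is the intended case.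
CharacteristicZero : ∀ {c ℓ} → CommutativeRing c ℓ → Set ℓ
CharacteristicZero K = ∀ k → k ×ᴷ 1# ≈ᴷ 0# → k ≡ 0
  where
  open CommutativeRing K using (1#; 0#; +-monoid) renaming (_≈_ to _≈ᴷ_)
  open Mult +-monoid renaming (_×_ to _×ᴷ_)

module _ {c ℓ} (K : CommutativeRing c ℓ) where
  open CommutativeRing K
    using (Carrier; 0#; 1#; _+_; _-_; -_; +-monoid)
    renaming (_≈_ to _≈ᴷ_)
  open Mult +-monoid renaming (_×_ to _×ᴷ_)
  open Sum +-monoid using (sum)

  fromℤ : ℤ → Carrier
  fromℤ (+ k)    = k ×ᴷ 1#
  fromℤ -[1+ k ] = - (suc k ×ᴷ 1#)

  actGen : ∀ {n} .{{_ : NonZero n}} → Fin n → Vector Carrier n → Vector Carrier n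
  actGen zero v =
    updateAt (updateAt v firstIx (const (v lastIx + 1#)))
             lastIx (const (v firstIx - 1#))
  actGen (suc i) v = v ∘ transpose (inject₁ i) (suc i)

  act : ∀ {n} .{{_ : NonZero n}} → Word n → Vector Carrier n → Vector Carrier n
  act w v = foldr actGen v w

  -- The span V of the roots is the hyperplane of vectors with coordinate sum 0.
  InV : ∀ {n} → Vector Carrier n → Set ℓ
  InV v = sum v ≈ᴷ 0#

  -- "w = t_x"
  IsTranslation : ∀ {n} .{{_ : NonZero n}} → Vector ℤ n → Word n → Set _
  IsTranslation x w = ∀ v → InV v → ∀ k → act w v k ≈ᴷ v k + fromℤ (x k)

------------------------------------------------------------------------
-- Affine roots and the level-zero action

open Sum ℤ.+-0-monoid using (sum)

-- Vectors of coefficients with respect to the basis α₀, α₁, …, αₙ₋₁.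
AffLattice : ℕ → Set
AffLattice = Vector ℤ

α : ∀ {n} → Fin n → AffLattice n
α = e

reflectSimple : ∀ {n} .{{_ : NonZero n}} → Fin n → Fin n → AffLattice n
reflectSimple j i =
  if does (i Fin.≟ j) then ⊝ α j
  else if does (adjacent? i j) then α i ⊕ α j
  else α i

reflect : ∀ {n} .{{_ : NonZero n}} → Fin n → AffLattice n → AffLattice n
reflect j β k = sum (λ i → β i ℤ.* reflectSimple j i k)

levelZero : ∀ {n} .{{_ : NonZero n}} → Word n → AffLattice n → AffLattice n
levelZero w β = foldr reflect β w

-- Since α₀ = δ - θ, every β in the lattice is uniquely x + p δ with x in Q and
-- p an integer; these are x = finitePart β and p = δ-coeff β.
simpleFinitePart : ∀ {n} .{{_ : NonZero n}} → Fin n → Vector ℤ n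
simpleFinitePart zero    = ⊝ θ
simpleFinitePart (suc i) = e (inject₁ i) ⊖ e (suc i)

finitePart : ∀ {n} .{{_ : NonZero n}} → AffLattice n → Vector ℤ n
finitePart β k = sum (λ i → β i ℤ.* simpleFinitePart i k)

δ-coeff : ∀ {n} .{{_ : NonZero n}} → AffLattice n → ℤ
δ-coeff {n} β = β (0 mod n)

-- β = (e i ⊖ e j) + p δ lies in R_af⁺.
IsPositiveRoot : ∀ {n} .{{_ : NonZero n}} → AffLattice n → Fin n → Fin n → Set
IsPositiveRoot β i j =
  i ≢ j × finitePart β ≗ (e i ⊖ e j) ×
  (0ℤ ℤ.< δ-coeff β ⊎ (δ-coeff β ≡ 0ℤ × i Fin.< j))

R⁺af : ∀ {n} .{{_ : NonZero n}} → AffLattice n → Set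
R⁺af β = ∃[ i ] ∃[ j ] IsPositiveRoot β i j

Rₚ⁺af : ∀ {n} .{{_ : NonZero n}} → ℕ → AffLattice n → Set
Rₚ⁺af m β = ∃[ i ] ∃[ j ] IsPositiveRoot β i j × SameBlock m i j

------------------------------------------------------------------------
-- The factorization and π_P, for I_P = {1,…,n-1} ∖ {m}

InS̃ᴾ : ∀ {n} .{{_ : NonZero n}} → ℕ → Word n → Set
InS̃ᴾ m w = ∀ β → Rₚ⁺af m β → R⁺af (levelZero w β)

InIₚ : ∀ {n} → ℕ → Fin n → Set
InIₚ m i = toℕ i ≢ 0 × toℕ i ≢ m

module _ {c ℓ} (K : CommutativeRing c ℓ) where

  InS̃ₚ : ∀ {n} .{{_ : NonZero n}} → ℕ → Word n → Set _
  InS̃ₚ {n} m w =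
    ∃[ v ] ∃[ x ] ∃[ t ]
      All (InIₚ m) v × InQₚ {n} m x × IsTranslation K x t × w ≈ v ++ t

  IsFactorization : ∀ {n} .{{_ : NonZero n}} → ℕ → Word n → Word n → Word n → Set _
  IsFactorization m w w₁ w₂ = InS̃ᴾ m w₁ × InS̃ₚ m w₂ × w ≈ w₁ ++ w₂

  -- "w₁ = π_P(w)".  The second component makes this a definite description:
  -- w₁ is the one element of S̃^P occurring in a factorization of w.
  Isπₚ : ∀ {n} .{{_ : NonZero n}} → ℕ → Word n → Word n → Set _
  Isπₚ m w w₁ =
    ∃ (IsFactorization m w w₁) ×
    (∀ u₁ u₂ → IsFactorization m w u₁ u₂ → u₁ ≈ w₁)

-- s_m s_{m+1} ⋯ s_{n-1} s_{m-1} s_{m-2} ⋯ s_1 s_0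
cycleWord : ∀ n .{{_ : NonZero n}} → ℕ → Word n
cycleWord n m = map (_mod n) (map (m ℕ.+_) (upTo (n ℕ.∸ m)) ++ downFrom m)

-- The affine action of a word w on coordinates is v ↦ v ∘ perm w + shift w, and
-- the level-zero action on affine roots is dual to it, so both are controlled by
-- the pair (perm w, shift w).  That this pair determines w up to _≈_ is
-- the faithfulness of a Coxeter group, proved by the classical dichotomy: either
-- w⁻¹αᵢ is positive or w ≈ sᵢ w′ with w′ shorter, by induction on the length and
-- reduction to the dihedral groups ⟨sᵢ, sₖ⟩.
--
-- Let C be the word of the theorem and V the word obtained from it by deleting
-- s_m and s₀.  Then V is parabolic, perm C ≡ perm V and shift C ≡ e_{m+1} - e_m,
-- so C⁻¹ t_{-θ} is V⁻¹ times a translation by an element of Q_P.  Conversely, if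
-- u ∈ S̃^P and t_{-θ} ∈ u S̃_P, then on each of the two blocks shift u is weakly
-- decreasing with at most two consecutive values, and shift u - shift C ∈ Q_P;
-- this forces shift u ≡ shift C.  Positivity of the roots e_i - e_j then
-- prescribes the order of the values of perm u on each block, whence
-- perm u ≡ perm C.

module Submission where

open import Defs
open import Algebra.Bundles using (CommutativeRing)
open import Data.Nat using (ℕ; _≤_; _∸_; NonZero)

import Algebra.Properties.AbelianGroup as AbelianGroupProperties
import Algebra.Properties.CommutativeMonoid.Sum as CommutativeMonoidSum
import Algebra.Properties.Group as GroupProperties
import Algebra.Properties.Monoid.Mult as MonoidMult
import Algebra.Properties.Monoid.Sum as MonoidSum
open import Data.Bool using (Bool; T; if_then_else_; true; false)
import Data.Bool.Properties as Bool
open import Data.Empty using (⊥; ⊥-elim)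
open import Data.Fin as Fin using (Fin; zero; suc; toℕ; inject₁; fromℕ<)
open import Data.Fin.Permutation.Components using (transpose)
import Data.Fin.Properties as Fin
open import Data.Integer as ℤ using (ℤ; -[1+_]; 0ℤ; 1ℤ; _+_; _-_; _*_; -_)
import Data.Integer.Properties as ℤ
open import Data.Integer.Tactic.RingSolver using (solve-∀)
open import Data.List
  using (List; []; _∷_; _++_; map; applyUpTo; upTo; downFrom; length; reverse)
open import Data.List.Properties
  using (length-++; ++-assoc; ++-identityʳ; map-++; map-upTo; unfold-reverse; reverse-involutive)
open import Data.List.Relation.Unary.All using (All; []; _∷_)
open import Data.List.Relation.Unary.All.Properties using (++⁺)
open import Data.Nat as ℕ using (zero; suc; z≤n; s≤s)
open import Data.Nat.DivMod using (_mod_; _%_; m<n⇒m%n≡m; n%n≡0; m%n<n)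
import Data.Nat.Properties as ℕ
open import Data.Product using (_×_; _,_; ∃-syntax)
open import Data.Sum using (_⊎_; inj₁; inj₂)
open import Data.Vec.Functional using (Vector; updateAt)
open import Data.Vec.Functional.Properties using (updateAt-updates; updateAt-minimal)
open import Function using (_∘_; const)
open import Relation.Binary.Bundles using (Setoid)
open import Relation.Binary.Definitions using (tri<; tri≈; tri>)
import Relation.Binary.PropositionalEquality as ≡
open ≡ using (_≡_; _≢_; _≗_; refl; cong; cong₂)
import Relation.Binary.Reasoning.Setoid as SetoidReasoning
open import Relation.Nullary using (¬_; Dec; does; yes; no; contradiction)
open import Relation.Nullary.Decidable using (dec-true; dec-false)

open CommutativeMonoidSum ℤ.+-0-commutativeMonoid
  using (sum; sum-cong-≗; ∑-distrib-+; sum-replicate-zero)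

-- Equality of words is generated by the relations, so `u ≈ w` has to be derived; the affine action
-- by itself can only refute it. The dichotomy supplies the derivations. To keep it elementary,
-- positivity of w⁻¹αᵢ is expressed as the sign of one integer: the value of αᵢ at the image of a
-- fixed point inside the alcove. That point naturally has coordinates with denominator n, so the
-- translation part of the action carries a factor N, and N = n clears the denominators. The ring K
-- enters only through the dictionary between translations and pairs (`perm`, `shift`); the rest is
-- integer arithmetic. Membership in Q_P controls only the sum of the entries over each block. It
-- becomes an equality of vectors by first proving an inequality on the block: its slack is
-- nonnegative and sums to zero.

e-refl : ∀ {n} (i : Fin n) → e i i ≡ 1ℤ
e-refl i = cong (if_then 1ℤ else 0ℤ) (dec-true (i Fin.≟ i) refl)

e-≢ : ∀ {n} {i k : Fin n} → i ≢ k → e i k ≡ 0ℤ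
e-≢ {i = i} {k} i≢k = cong (if_then 1ℤ else 0ℤ) (dec-false (i Fin.≟ k) i≢k)

e-sym : ∀ {n} (i k : Fin n) → e i k ≡ e k i
e-sym i k with i Fin.≟ k
... | yes refl = ≡.sym (e-refl i)
... | no i≢k = ≡.sym (e-≢ (i≢k ∘ ≡.sym))

-- This is the reflection formula in e_a - e_b. It turns a case distinction on positions into an
-- expression that the ring solver can handle.
transpose-at : ∀ {n} {a b : Fin n} → a ≢ b → (X : Vector ℤ n) → ∀ k →
  X (transpose a b k) ≡ X k - (X a - X b) * (e a k - e b k)
transpose-at {a = a} {b} a≢b X k with k Fin.≟ a
... | yes refl rewrite e-refl k | e-≢ (a≢b ∘ ≡.sym) = lem (X k) (X b)
  where
  lem : ∀ x y → y ≡ x - (x - y) * (1ℤ - 0ℤ)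
  lem = solve-∀
... | no k≢a with k Fin.≟ b
... | yes refl rewrite e-refl k | e-≢ a≢b = lem (X a) (X k)
  where
  lem : ∀ x y → x ≡ y - (x - y) * (0ℤ - 1ℤ)
  lem = solve-∀
... | no k≢b rewrite e-≢ (k≢a ∘ ≡.sym) | e-≢ (k≢b ∘ ≡.sym) = lem (X a) (X b) (X k)
  where
  lem : ∀ x y z → z ≡ z - (x - y) * (0ℤ - 0ℤ)
  lem = solve-∀

*-distribˡ-minus : ∀ x a b → x * (a - b) ≡ x * a - x * b
*-distribˡ-minus = solve-∀

-- Finite sums of integers.

sum-*0 : ∀ {n} (f : Vector ℤ n) → sum (λ i → f i * 0ℤ) ≡ 0ℤ
sum-*0 {n} f = ≡.trans (sum-cong-≗ (λ i → ℤ.*-zeroʳ (f i))) (sum-replicate-zero n)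

sum-e : ∀ {n} (f : Vector ℤ n) k → sum (λ i → f i * e i k) ≡ f k
sum-e {suc n} f zero = ≡.trans
  (cong₂ _+_ (ℤ.*-identityʳ (f zero)) (sum-*0 (f ∘ suc)))
  (ℤ.+-identityʳ (f zero))
sum-e {suc n} f (suc k) = ≡.trans
  (cong₂ _+_ (ℤ.*-zeroʳ (f zero)) (sum-e (f ∘ suc) k))
  (ℤ.+-identityˡ (f (suc k)))

sum-e-total : ∀ {n} (i : Fin n) → sum (e i) ≡ 1ℤ
sum-e-total i = ≡.trans
  (sum-cong-≗ (λ k → ≡.trans (e-sym i k) (≡.sym (ℤ.*-identityˡ (e k i)))))
  (sum-e (const 1ℤ) i)

sum-neg : ∀ {n} (f : Vector ℤ n) → sum (λ i → - f i) ≡ - sum f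
sum-neg {zero} f = refl
sum-neg {suc n} f = ≡.trans (cong ((- f zero) +_) (sum-neg (f ∘ suc))) (≡.sym (ℤ.neg-distrib-+ (f zero) _))

sum-minus : ∀ {n} (f g : Vector ℤ n) → sum (λ i → f i - g i) ≡ sum f - sum g
sum-minus f g = ≡.trans (∑-distrib-+ f (-_ ∘ g)) (cong (sum f +_) (sum-neg g))

sum-*ʳ : ∀ {n} (f : Vector ℤ n) c → sum (λ i → f i * c) ≡ sum f * c
sum-*ʳ {zero} f c = refl
sum-*ʳ {suc n} f c = ≡.trans (cong (f zero * c +_) (sum-*ʳ (f ∘ suc) c))
  (≡.sym (ℤ.*-distribʳ-+ c (f zero) _))

sum-nonneg : ∀ {l} (f : Vector ℤ l) → (∀ k → 0ℤ ℤ.≤ f k) → 0ℤ ℤ.≤ sum f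
sum-nonneg {zero} f f≥0 = ℤ.≤-refl
sum-nonneg {suc l} f f≥0 = ℤ.+-mono-≤ (f≥0 zero) (sum-nonneg (f ∘ suc) (f≥0 ∘ suc))

sum-zero⇒zero : ∀ {l} (f : Vector ℤ l) → (∀ k → 0ℤ ℤ.≤ f k) → sum f ≡ 0ℤ → ∀ k → f k ≡ 0ℤ
sum-zero⇒zero f f≥0 Σf≡0 zero = ℤ.≤-antisym (begin
    f zero                    ≡⟨ ℤ.+-identityʳ (f zero) ⟨
    f zero + 0ℤ               ≤⟨ ℤ.+-monoʳ-≤ (f zero) (sum-nonneg (f ∘ suc) (f≥0 ∘ suc)) ⟩
    f zero + sum (f ∘ suc)    ≡⟨ Σf≡0 ⟩
    0ℤ ∎) (f≥0 zero)
  where open ℤ.≤-Reasoning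
sum-zero⇒zero f f≥0 Σf≡0 (suc k) = sum-zero⇒zero (f ∘ suc) (f≥0 ∘ suc)
  (ℤ.≤-antisym (begin
    sum (f ∘ suc)             ≡⟨ ℤ.+-identityˡ _ ⟨
    0ℤ + sum (f ∘ suc)        ≤⟨ ℤ.+-monoˡ-≤ (sum (f ∘ suc)) (f≥0 zero) ⟩
    f zero + sum (f ∘ suc)    ≡⟨ Σf≡0 ⟩
    0ℤ ∎) (sum-nonneg (f ∘ suc) (f≥0 ∘ suc))) k
  where open ℤ.≤-Reasoning

reverse⁺ : ∀ {A : Set} {P : A → Set} {xs} → All P xs → All P (reverse xs)
reverse⁺ [] = []
reverse⁺ {P = P} {x ∷ xs} (px ∷ pxs) =
  ≡.subst (All P) (≡.sym (unfold-reverse x xs)) (++⁺ (reverse⁺ pxs) (px ∷ []))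

-- Increasing and decreasing runs of letters.

rise : ℕ → ℕ → List ℕ
rise a zero    = []
rise a (suc d) = a ∷ rise (suc a) d

-- Stops at 1: the final 0 of `downFrom` is the letter s₀, which is treated apart from the parabolic
-- letters.
fall : ℕ → List ℕ
fall zero    = []
fall (suc k) = suc k ∷ fall k

applyUpTo-rise : ∀ {f a} d → (∀ i → f i ≡ a ℕ.+ i) → applyUpTo f d ≡ rise a d
applyUpTo-rise zero f≡ = refl
applyUpTo-rise {a = a} (suc d) f≡ = cong₂ _∷_ (≡.trans (f≡ 0) (ℕ.+-identityʳ a))
  (applyUpTo-rise d (λ i → ≡.trans (f≡ (suc i)) (ℕ.+-suc a i)))

downFrom-fall : ∀ k → downFrom (suc k) ≡ fall k ++ 0 ∷ []
downFrom-fall zero = refl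
downFrom-fall (suc k) = cong (suc k ∷_) (downFrom-fall k)

module Affine (n′ : ℕ) where

  n : ℕ
  n = 3 ℕ.+ n′

  -- Neighbours in the cyclic index set.

  prev : Fin n → Fin n
  prev zero    = lastIx
  prev (suc i) = inject₁ i

  toℕ-mod : ∀ {k} → k ℕ.< n → toℕ (k mod n) ≡ k
  toℕ-mod {k} k<n = ≡.trans (Fin.toℕ-fromℕ< (m%n<n k n)) (m<n⇒m%n≡m k<n)

  toℕ-last : toℕ (lastIx {n}) ≡ suc (suc n′)
  toℕ-last = toℕ-mod ℕ.≤-refl

  toℕ-next : ∀ i → suc (toℕ i) ℕ.< n → toℕ (next i) ≡ suc (toℕ i)
  toℕ-next i = toℕ-mod

  next-last : ∀ i → suc (toℕ i) ≡ n → next i ≡ zero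
  next-last i eq = Fin.toℕ-injective
    (≡.trans (Fin.toℕ-fromℕ< (m%n<n (suc (toℕ i)) n)) (≡.trans (cong (_% n) eq) (n%n≡0 n)))

  toℕ-prev : ∀ {i k} → toℕ i ≡ suc k → toℕ (prev i) ≡ k
  toℕ-prev {suc i} refl = Fin.toℕ-inject₁ i

  next-prev : ∀ i → next (prev i) ≡ i
  next-prev zero = next-last lastIx (cong suc toℕ-last)
  next-prev (suc i) = Fin.toℕ-injective (≡.trans
    (toℕ-next (inject₁ i) (s≤s (≡.subst (ℕ._< suc (suc n′)) (≡.sym (Fin.toℕ-inject₁ i)) (Fin.toℕ<n i))))
    (cong suc (Fin.toℕ-inject₁ i)))

  prev-next : ∀ i → prev (next i) ≡ i
  prev-next i with suc (toℕ i) ℕ.<? n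
  ... | yes lt = Fin.toℕ-injective (toℕ-prev (toℕ-next i lt))
  ... | no ≮ = ≡.trans (cong prev (next-last i eq))
                 (Fin.toℕ-injective (≡.trans toℕ-last (≡.sym (ℕ.suc-injective eq))))
    where eq = ℕ.≤-antisym (Fin.toℕ<n i) (ℕ.≮⇒≥ ≮)

  prev-injective : ∀ {i j} → prev i ≡ prev j → i ≡ j
  prev-injective {i} {j} eq = ≡.trans (≡.sym (next-prev i)) (≡.trans (cong next eq) (next-prev j))

  prev≢ : ∀ i → prev i ≢ i
  prev≢ zero eq with () ← ≡.trans (≡.sym toℕ-last) (cong toℕ eq)
  prev≢ (suc i) eq = ℕ.1+n≢n (≡.sym (≡.trans (≡.sym (Fin.toℕ-inject₁ i)) (cong toℕ eq)))

  -- Here n ≥ 3 is essential: for n = 2 both neighbours of i coincide, and the off-diagonal Cartan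
  -- entry would be -2 instead of -1.
  prev²≢ : ∀ i → prev (prev i) ≢ i
  prev²≢ zero eq with () ← ≡.trans (≡.sym (toℕ-prev {lastIx} toℕ-last)) (cong toℕ eq)
  prev²≢ (suc zero) eq with () ← ≡.trans (≡.sym toℕ-last) (cong toℕ eq)
  prev²≢ (suc (suc i)) eq = ℕ.m+1+n≢n 1 (≡.sym (≡.trans
    (≡.sym (≡.trans (Fin.toℕ-inject₁ (inject₁ i)) (Fin.toℕ-inject₁ i))) (cong toℕ eq)))

  adjacent⇒prev : ∀ {i j} → Adjacent i j → prev j ≡ i ⊎ prev i ≡ j
  adjacent⇒prev {i} (inj₁ refl) = inj₁ (prev-next i)
  adjacent⇒prev {j = j} (inj₂ refl) = inj₂ (prev-next j)

  prev⇒adjacent : ∀ {i j} → prev j ≡ i ⊎ prev i ≡ j → Adjacent i j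
  prev⇒adjacent {j = j} (inj₁ refl) = inj₁ (≡.sym (next-prev j))
  prev⇒adjacent {i} (inj₂ refl) = inj₂ (≡.sym (next-prev i))

  -- The finite part of αⱼ. Since c_k sits at position k - 1, αⱼ occupies the positions `prev j` and
  -- `j`; for j = 0 the wrap-around of `prev` yields e_n - e_1 = -θ.
  coroot : Fin n → Vector ℤ n
  coroot j k = e (prev j) k - e j k

  cartan : Fin n → Fin n → ℤ
  cartan i j = coroot j (prev i) - coroot j i

  cartan-self : ∀ i → cartan i i ≡ ℤ.+ 2
  cartan-self i rewrite e-refl (prev i) | e-refl i | e-≢ (prev≢ i) | e-≢ (prev≢ i ∘ ≡.sym) = refl

  cartan-adjacent : ∀ {i j} → Adjacent i j → cartan i j ≡ - 1ℤ
  cartan-adjacent {i} {j} adj with adjacent⇒prev adj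
  ... | inj₁ refl
    rewrite e-refl (prev j) | e-≢ (prev≢ i ∘ ≡.sym) | e-≢ (prev≢ j ∘ ≡.sym) | e-≢ (prev²≢ j ∘ ≡.sym)
    = refl
  ... | inj₂ refl
    rewrite e-refl (prev i) | e-≢ (prev≢ (prev i)) | e-≢ (prev²≢ i) | e-≢ (prev≢ i) = refl

  cartan-far : ∀ {i j} → i ≢ j → ¬ Adjacent i j → cartan i j ≡ 0ℤ
  cartan-far {i} {j} i≢j ¬adj
    rewrite e-≢ {i = prev j} {prev i} (λ eq → i≢j (≡.sym (prev-injective eq)))
          | e-≢ {i = j} {prev i} (λ eq → ¬adj (prev⇒adjacent (inj₂ (≡.sym eq))))
          | e-≢ {i = prev j} {i} (λ eq → ¬adj (prev⇒adjacent (inj₁ eq)))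
          | e-≢ (i≢j ∘ ≡.sym) = refl

  -- Permutation and translation part of a word.

  permGen : Fin n → Fin n → Fin n
  permGen j = transpose (prev j) j

  -- The factor `e j zero` singles out s₀, which adds 1 to the first coordinate and subtracts 1 from
  -- the last.
  shiftGen : Fin n → Fin n → ℤ
  shiftGen j k = - (e j zero * coroot j k)

  -- Precomposition reverses the order: the leftmost letter acts last on vectors but first on
  -- positions.
  perm : Word n → Fin n → Fin n
  perm []      k = k
  perm (j ∷ w) k = perm w (permGen j k)

  shift : Word n → Fin n → ℤ
  shift []      k = 0ℤ
  shift (j ∷ w) k = shift w (permGen j k) + shiftGen j k

  perm-++ : ∀ u w k → perm (u ++ w) k ≡ perm w (perm u k)
  perm-++ [] w k = refl
  perm-++ (j ∷ u) w k = perm-++ u w (permGen j k)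

  shift-++ : ∀ u w k → shift (u ++ w) k ≡ shift w (perm u k) + shift u k
  shift-++ [] w k = ≡.sym (ℤ.+-identityʳ _)
  shift-++ (j ∷ u) w k = ≡.trans (cong (_+ shiftGen j k) (shift-++ u w (permGen j k)))
    (ℤ.+-assoc (shift w (perm u (permGen j k))) (shift u (permGen j k)) (shiftGen j k))

  -- The affine action on integer vectors, with the translation part scaled by N.
  move : ℤ → Word n → Vector ℤ n → Vector ℤ n
  move N w X k = X (perm w k) + N * shift w k

  -- The value at X of the affine functional αᵢ with δ evaluated to N; it vanishes exactly on the
  -- wall of sᵢ.
  height : ℤ → Vector ℤ n → Fin n → ℤ
  height N X i = X (prev i) - X i + N * e i zero

  move-[] : ∀ N X → move N [] X ≗ X
  move-[] N X k = lem N (X k)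
    where
    lem : ∀ N x → x + N * 0ℤ ≡ x
    lem = solve-∀

  move-cong : ∀ N w {X Y} → X ≗ Y → move N w X ≗ move N w Y
  move-cong N w X≗Y k = cong (_+ N * shift w k) (X≗Y (perm w k))

  move-++ : ∀ N u w X → move N (u ++ w) X ≗ move N u (move N w X)
  move-++ N u w X k rewrite perm-++ u w k | shift-++ u w k = lem N (X _) (shift w (perm u k)) (shift u k)
    where
    lem : ∀ N x a b → x + N * (a + b) ≡ x + N * a + N * b
    lem = solve-∀

  -- Every generator, s₀ included, is the reflection in its wall: the translation of s₀ is absorbed
  -- by the term N of `height`.
  move-gen : ∀ N j X → move N (j ∷ []) X ≗ λ k → X k - height N X j * coroot j k
  move-gen N j X k = ≡.trans (cong (_+ N * shift (j ∷ []) k) (transpose-at (prev≢ j) X k))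
      (lem N (X k) (X (prev j)) (X j) (coroot j k) (e j zero))
    where
    lem : ∀ N x a b r z → x - (a - b) * r + N * (0ℤ + - (z * r)) ≡ x - (a - b + N * z) * r
    lem = solve-∀

  height-cong : ∀ N {X Y} → X ≗ Y → height N X ≗ height N Y
  height-cong N X≗Y i = cong (_+ N * e i zero) (cong₂ _-_ (X≗Y (prev i)) (X≗Y i))

  height-minus : ∀ N X c j i → height N (λ k → X k - c * coroot j k) i ≡ height N X i - c * cartan i j
  height-minus N X c j i = lem N (X (prev i)) (X i) (e i zero) c (coroot j (prev i)) (coroot j i)
    where
    lem : ∀ N x y z c a b → x - c * a - (y - c * b) + N * z ≡ x - y + N * z - c * (a - b)
    lem = solve-∀

  -- Heights form a closed system under the generators, so each defining relation reduces to a
  -- polynomial identity in two heights and two coroots.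
  height-gen : ∀ N j X i → height N (move N (j ∷ []) X) i ≡ height N X i - height N X j * cartan i j
  height-gen N j X i = ≡.trans (height-cong N (move-gen N j X) i) (height-minus N X (height N X j) j i)

  move-square : ∀ N i X → move N (i ∷ i ∷ []) X ≗ X
  move-square N i X k = begin
    move N (i ∷ i ∷ []) X k                     ≡⟨ move-++ N (i ∷ []) (i ∷ []) X k ⟩
    move N (i ∷ []) Y k                         ≡⟨ move-gen N i Y k ⟩
    Y k - height N Y i * coroot i k
      ≡⟨ cong₂ (λ y h → y - h * coroot i k) (move-gen N i X k)
           (≡.trans (height-gen N i X i) (cong (λ c → p - p * c) (cartan-self i))) ⟩
    X k - p * coroot i k - (p - p * ℤ.+ 2) * coroot i k ≡⟨ lem (X k) p (coroot i k) ⟩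
    X k ∎
    where
    open ≡.≡-Reasoning
    p = height N X i
    Y = move N (i ∷ []) X
    lem : ∀ x p r → x - p * r - (p - p * ℤ.+ 2) * r ≡ x
    lem = solve-∀

  move-pair : ∀ N i j X k → move N (i ∷ j ∷ []) X k ≡
    X k - height N X j * coroot j k - (height N X i - height N X j * cartan i j) * coroot i k
  move-pair N i j X k = begin
    move N (i ∷ j ∷ []) X k         ≡⟨ move-++ N (i ∷ []) (j ∷ []) X k ⟩
    move N (i ∷ []) Y k             ≡⟨ move-gen N i Y k ⟩
    Y k - height N Y i * coroot i k
      ≡⟨ cong₂ (λ y h → y - h * coroot i k) (move-gen N j X k) (height-gen N j X i) ⟩
    X k - height N X j * coroot j k - (height N X i - height N X j * cartan i j) * coroot i k ∎
    where
    open ≡.≡-Reasoning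
    Y = move N (j ∷ []) X

  adjacent-sym : ∀ {i j : Fin n} → Adjacent i j → Adjacent j i
  adjacent-sym (inj₁ p) = inj₂ p
  adjacent-sym (inj₂ p) = inj₁ p

  move-commute : ∀ N i j → ¬ Adjacent i j → ∀ X → move N (i ∷ j ∷ []) X ≗ move N (j ∷ i ∷ []) X
  move-commute N i j ¬adj X k with i Fin.≟ j
  ... | yes refl = refl
  ... | no i≢j = begin
    move N (i ∷ j ∷ []) X k ≡⟨ move-pair N i j X k ⟩
    X k - q * b - (p - q * cartan i j) * a
      ≡⟨ cong (λ c → X k - q * b - (p - q * c) * a) (cartan-far i≢j ¬adj) ⟩
    X k - q * b - (p - q * 0ℤ) * a ≡⟨ lem (X k) p q a b ⟩
    X k - p * a - (q - p * 0ℤ) * b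
      ≡⟨ cong (λ c → X k - p * a - (q - p * c) * b) (cartan-far (i≢j ∘ ≡.sym) (¬adj ∘ adjacent-sym)) ⟨
    X k - p * a - (q - p * cartan j i) * b ≡⟨ move-pair N j i X k ⟨
    move N (j ∷ i ∷ []) X k ∎
    where
    open ≡.≡-Reasoning
    p = height N X i
    q = height N X j
    a = coroot i k
    b = coroot j k
    lem : ∀ x p q a b → x - q * b - (p - q * 0ℤ) * a ≡ x - p * a - (q - p * 0ℤ) * b
    lem = solve-∀

  -- The product is the reflection in αᵢ + αⱼ. The right side is symmetric in i and j, which is the
  -- braid relation.
  move-triple : ∀ N {i j} → Adjacent i j → ∀ X k → move N (i ∷ j ∷ i ∷ []) X k ≡
    X k - (height N X i + height N X j) * (coroot i k + coroot j k)
  move-triple N {i} {j} adj X k = begin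
    move N (i ∷ j ∷ i ∷ []) X k ≡⟨ move-++ N (i ∷ j ∷ []) (i ∷ []) X k ⟩
    move N (i ∷ j ∷ []) Y k ≡⟨ move-pair N i j Y k ⟩
    Y k - height N Y j * b - (height N Y i - height N Y j * cartan i j) * a
      ≡⟨ cong₂ (λ y c → y - height N Y j * b - (height N Y i - height N Y j * c) * a)
           (move-gen N i X k) (cartan-adjacent adj) ⟩
    X k - p * a - height N Y j * b - (height N Y i - height N Y j * - 1ℤ) * a
      ≡⟨ cong₂ (λ s t → X k - p * a - t * b - (s - t * - 1ℤ) * a)
           (≡.trans (height-gen N i X i) (cong (λ c → p - p * c) (cartan-self i)))
           (≡.trans (height-gen N i X j) (cong (λ c → q - p * c) (cartan-adjacent (adjacent-sym adj)))) ⟩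
    X k - p * a - (q - p * - 1ℤ) * b - (p - p * ℤ.+ 2 - (q - p * - 1ℤ) * - 1ℤ) * a
      ≡⟨ lem (X k) p q a b ⟩
    X k - (p + q) * (a + b) ∎
    where
    open ≡.≡-Reasoning
    Y = move N (i ∷ []) X
    p = height N X i
    q = height N X j
    a = coroot i k
    b = coroot j k
    lem : ∀ x p q a b → x - p * a - (q - p * - 1ℤ) * b - (p - p * ℤ.+ 2 - (q - p * - 1ℤ) * - 1ℤ) * a
      ≡ x - (p + q) * (a + b)
    lem = solve-∀

  -- One verification of the relations serves three invariants: N = 0 at a vector with distinct
  -- entries gives `perm`, N = 1 at the origin gives `shift`, and N = n at `base` gives `depth`.
  move-≈ : ∀ N {u w} → u ≈ w → ∀ X → move N u X ≗ move N w X
  move-≈ N refl X k = refl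
  move-≈ N (sym p) X k = ≡.sym (move-≈ N p X k)
  move-≈ N (trans p q) X k = ≡.trans (move-≈ N p X k) (move-≈ N q X k)
  move-≈ N (++-cong {u} {u′} {v} {v′} p q) X k = begin
    move N (u ++ v) X k      ≡⟨ move-++ N u v X k ⟩
    move N u (move N v X) k  ≡⟨ move-≈ N p (move N v X) k ⟩
    move N u′ (move N v X) k ≡⟨ move-cong N u′ (move-≈ N q X) k ⟩
    move N u′ (move N v′ X) k ≡⟨ move-++ N u′ v′ X k ⟨
    move N (u′ ++ v′) X k ∎
    where open ≡.≡-Reasoning
  move-≈ N (square i) X k = ≡.trans (move-square N i X k) (≡.sym (move-[] N X k))
  move-≈ N (braid i) X k = begin
    move N (i ∷ j ∷ i ∷ []) X k ≡⟨ move-triple N (inj₁ refl) X k ⟩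
    X k - (height N X i + height N X j) * (coroot i k + coroot j k)
      ≡⟨ cong₂ (λ h c → X k - h * c) (ℤ.+-comm (height N X i) _) (ℤ.+-comm (coroot i k) _) ⟩
    X k - (height N X j + height N X i) * (coroot j k + coroot i k)
      ≡⟨ move-triple N (inj₂ refl) X k ⟨
    move N (j ∷ i ∷ j ∷ []) X k ∎
    where
    open ≡.≡-Reasoning
    j = next i
  move-≈ N (commute i j ¬adj) X k = move-commute N i j ¬adj X k

  perm-≈ : ∀ {u w} → u ≈ w → perm u ≗ perm w
  perm-≈ {u} {w} p k = Fin.toℕ-injective (ℤ.+-injective (begin
    ℤ.+ toℕ (perm u k)             ≡⟨ ℤ.+-identityʳ _ ⟨
    move 0ℤ u (ℤ.+_ ∘ toℕ) k       ≡⟨ move-≈ 0ℤ p (ℤ.+_ ∘ toℕ) k ⟩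
    move 0ℤ w (ℤ.+_ ∘ toℕ) k       ≡⟨ ℤ.+-identityʳ _ ⟩
    ℤ.+ toℕ (perm w k) ∎))
    where open ≡.≡-Reasoning

  shift-≈ : ∀ {u w} → u ≈ w → shift u ≗ shift w
  shift-≈ {u} {w} p k = begin
    shift u k                     ≡⟨ lem (shift u k) ⟨
    move 1ℤ u (const 0ℤ) k       ≡⟨ move-≈ 1ℤ p (const 0ℤ) k ⟩
    move 1ℤ w (const 0ℤ) k       ≡⟨ lem (shift w k) ⟩
    shift w k ∎
    where
    open ≡.≡-Reasoning
    lem : ∀ x → 0ℤ + 1ℤ * x ≡ x
    lem = solve-∀

  -- The word problem

  -- Since 0 > -1 > ⋯ > 1 - n > 0 - n, the base point is interior to the
  -- fundamental alcove, so depth w i > 0 exactly when w⁻¹αᵢ is a positive root.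
  base : Vector ℤ n
  base k = - (ℤ.+ toℕ k)

  depth : Word n → Fin n → ℤ
  depth w = height (ℤ.+ n) (move (ℤ.+ n) w base)

  -- The n heights of any vector telescope to N, so N = n is the scale at which all of them can
  -- equal 1.
  height-base : ∀ i → height (ℤ.+ n) base i ≡ 1ℤ
  height-base zero = ≡.trans
    (cong (λ l → - (ℤ.+ l) - - 0ℤ + ℤ.+ n * 1ℤ) toℕ-last) (lem (ℤ.+ n′))
    where
    lem : ∀ x → - (ℤ.+ 2 + x) - - 0ℤ + (ℤ.+ 3 + x) * 1ℤ ≡ 1ℤ
    lem = solve-∀
  height-base (suc i) = ≡.trans
    (cong (λ l → - (ℤ.+ l) - - (1ℤ + ℤ.+ toℕ i) + ℤ.+ n * 0ℤ) (Fin.toℕ-inject₁ i))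
    (lem (ℤ.+ toℕ i) (ℤ.+ n))
    where
    lem : ∀ x n → - x - - (1ℤ + x) + n * 0ℤ ≡ 1ℤ
    lem = solve-∀

  depth-[] : ∀ i → depth [] i ≡ 1ℤ
  depth-[] i = ≡.trans (height-cong (ℤ.+ n) (move-[] (ℤ.+ n) base) i) (height-base i)

  depth-≈ : ∀ {u w} → u ≈ w → depth u ≗ depth w
  depth-≈ p = height-cong (ℤ.+ n) (move-≈ (ℤ.+ n) p base)

  depth-∷ : ∀ j w i → depth (j ∷ w) i ≡ depth w i - depth w j * cartan i j
  depth-∷ j w i = ≡.trans (height-cong (ℤ.+ n) (move-++ (ℤ.+ n) (j ∷ []) w base) i)
                          (height-gen (ℤ.+ n) j (move (ℤ.+ n) w base) i)

  depth-self : ∀ i w → depth (i ∷ w) i ≡ - depth w i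
  depth-self i w = ≡.trans (depth-∷ i w i)
    (≡.trans (cong (λ c → depth w i - depth w i * c) (cartan-self i)) (lem (depth w i)))
    where
    lem : ∀ x → x - x * ℤ.+ 2 ≡ - x
    lem = solve-∀

  depth-adjacent : ∀ {i k} → Adjacent i k → ∀ w → depth (k ∷ w) i ≡ depth w i + depth w k
  depth-adjacent {i} {k} adj w = ≡.trans (depth-∷ k w i)
    (≡.trans (cong (λ c → depth w i - depth w k * c) (cartan-adjacent adj)) (lem (depth w i) (depth w k)))
    where
    lem : ∀ x y → x - y * - 1ℤ ≡ x + y
    lem = solve-∀

  depth-far : ∀ {i k} → i ≢ k → ¬ Adjacent i k → ∀ w → depth (k ∷ w) i ≡ depth w i
  depth-far {i} {k} i≢k ¬adj w = ≡.trans (depth-∷ k w i)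
    (≡.trans (cong (λ c → depth w i - depth w k * c) (cartan-far i≢k ¬adj)) (lem (depth w i) (depth w k)))
    where
    lem : ∀ x y → x - y * 0ℤ ≡ x
    lem = solve-∀

  ≈-setoid : Setoid _ _
  ≈-setoid = record
    { Carrier = Word n ; _≈_ = _≈_
    ; isEquivalence = record { refl = refl ; sym = sym ; trans = trans } }

  module ≈-Reasoning = SetoidReasoning ≈-setoid

  ∷-cong : ∀ (i : Fin n) {u w} → u ≈ w → i ∷ u ≈ i ∷ w
  ∷-cong i = ++-cong {u = i ∷ []} refl

  cancel : ∀ (i : Fin n) w → i ∷ i ∷ w ≈ w
  cancel i w = ++-cong (square i) (refl {u = w})

  braid-adjacent : ∀ {i k : Fin n} → Adjacent i k → i ∷ k ∷ i ∷ [] ≈ k ∷ i ∷ k ∷ []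
  braid-adjacent {i} (inj₁ refl) = braid i
  braid-adjacent {k = k} (inj₂ refl) = sym (braid k)

  -- Normal forms for the six elements of ⟨sᵢ, sₖ⟩ with i, k adjacent. The longest element is listed
  -- only as i k i, so that a form not starting with i is one after which αᵢ stays positive.
  data Alternating (i k : Fin n) : Word n → Set where
    ⟨⟩    : Alternating i k []
    ⟨i⟩   : Alternating i k (i ∷ [])
    ⟨k⟩   : Alternating i k (k ∷ [])
    ⟨ik⟩  : Alternating i k (i ∷ k ∷ [])
    ⟨ki⟩  : Alternating i k (k ∷ i ∷ [])
    ⟨iki⟩ : Alternating i k (i ∷ k ∷ i ∷ [])

  IsLetter : Fin n → Fin n → Fin n → Set
  IsLetter i k l = l ≡ i ⊎ l ≡ k

  -- The length bound ensures that what follows a leading i in the normal form is strictly shorter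
  -- than d.
  Normalizes : Fin n → Fin n → Word n → Set
  Normalizes i k d = ∃[ d′ ] Alternating i k d′ × d ≈ d′ × length d′ ≤ length d

  normalize-adjacent : ∀ {i k : Fin n} → Adjacent i k → ∀ {d} → All (IsLetter i k) d → Normalizes i k d
  normalize-adjacent adj [] = [] , ⟨⟩ , refl , z≤n
  normalize-adjacent {i} {k} adj {l ∷ d} (l∈ ∷ ls) with normalize-adjacent adj ls
  ... | d′ , alt , d≈d′ , le = let d″ , alt″ , p , le″ = prepend l∈ alt in
          d″ , alt″ , trans (∷-cong l d≈d′) p , ℕ.≤-trans le″ (s≤s le)
    where
    prepend : ∀ {l d} → IsLetter i k l → Alternating i k d → Normalizes i k (l ∷ d)
    prepend (inj₁ refl) ⟨⟩ = _ , ⟨i⟩ , refl , ℕ.≤-refl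
    prepend (inj₁ refl) ⟨i⟩ = _ , ⟨⟩ , square i , z≤n
    prepend (inj₁ refl) ⟨k⟩ = _ , ⟨ik⟩ , refl , ℕ.≤-refl
    prepend (inj₁ refl) ⟨ik⟩ = _ , ⟨k⟩ , cancel i _ , ℕ.m≤n+m 1 2
    prepend (inj₁ refl) ⟨ki⟩ = _ , ⟨iki⟩ , refl , ℕ.≤-refl
    prepend (inj₁ refl) ⟨iki⟩ = _ , ⟨ki⟩ , cancel i _ , ℕ.m≤n+m 2 2
    prepend (inj₂ refl) ⟨⟩ = _ , ⟨k⟩ , refl , ℕ.≤-refl
    prepend (inj₂ refl) ⟨i⟩ = _ , ⟨ki⟩ , refl , ℕ.≤-refl
    prepend (inj₂ refl) ⟨k⟩ = _ , ⟨⟩ , square k , z≤n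
    prepend (inj₂ refl) ⟨ik⟩ = _ , ⟨iki⟩ , sym (braid-adjacent adj) , ℕ.≤-refl
    prepend (inj₂ refl) ⟨ki⟩ = _ , ⟨i⟩ , cancel k _ , ℕ.m≤n+m 1 2
    prepend (inj₂ refl) ⟨iki⟩ = _ , ⟨ik⟩ , trans (∷-cong k (braid-adjacent adj)) (cancel k _) , ℕ.m≤n+m 2 2

  data Commuting (i k : Fin n) : Word n → Set where
    ⟨⟩   : Commuting i k []
    ⟨i⟩  : Commuting i k (i ∷ [])
    ⟨k⟩  : Commuting i k (k ∷ [])
    ⟨ik⟩ : Commuting i k (i ∷ k ∷ [])

  normalize-far : ∀ {i k : Fin n} → ¬ Adjacent i k → ∀ {d} → All (IsLetter i k) d →
    ∃[ d′ ] Commuting i k d′ × d ≈ d′ × length d′ ≤ length d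
  normalize-far ¬adj [] = [] , ⟨⟩ , refl , z≤n
  normalize-far {i} {k} ¬adj {l ∷ d} (l∈ ∷ ls) with normalize-far ¬adj ls
  ... | d′ , com , d≈d′ , le = let d″ , com″ , p , le″ = prepend l∈ com in
          d″ , com″ , trans (∷-cong l d≈d′) p , ℕ.≤-trans le″ (s≤s le)
    where
    swap : k ∷ i ∷ [] ≈ i ∷ k ∷ []
    swap = sym (commute i k ¬adj)
    prepend : ∀ {l d} → IsLetter i k l → Commuting i k d →
      ∃[ d′ ] Commuting i k d′ × l ∷ d ≈ d′ × length d′ ≤ length (l ∷ d)
    prepend (inj₁ refl) ⟨⟩ = _ , ⟨i⟩ , refl , ℕ.≤-refl
    prepend (inj₁ refl) ⟨i⟩ = _ , ⟨⟩ , square i , z≤n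
    prepend (inj₁ refl) ⟨k⟩ = _ , ⟨ik⟩ , refl , ℕ.≤-refl
    prepend (inj₁ refl) ⟨ik⟩ = _ , ⟨k⟩ , cancel i _ , ℕ.m≤n+m 1 2
    prepend (inj₂ refl) ⟨⟩ = _ , ⟨k⟩ , refl , ℕ.≤-refl
    prepend (inj₂ refl) ⟨i⟩ = _ , ⟨ik⟩ , swap , ℕ.≤-refl
    prepend (inj₂ refl) ⟨k⟩ = _ , ⟨⟩ , square k , z≤n
    prepend (inj₂ refl) ⟨ik⟩ = _ , ⟨i⟩ , trans (∷-cong k (commute i k ¬adj)) (cancel k _) , ℕ.m≤n+m 1 2

  Positive : Word n → Fin n → Set
  Positive w i = 0ℤ ℤ.< depth w i

  Dichotomy : Word n → Fin n → Set
  Dichotomy w i = Positive w i ⊎ ∃[ w′ ] w ≈ i ∷ w′ × length w′ ℕ.< length w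

  -- For a normal form not starting with i, the depth at i is `depth v i`, `depth v k` or their sum,
  -- hence positive by the two hypotheses.
  dihedral : ∀ {i k : Fin n} → i ≢ k → ∀ {d v} → All (IsLetter i k) d → Positive v i → Positive v k →
    Positive (d ++ v) i ⊎ ∃[ d′ ] d ≈ i ∷ d′ × length d′ ℕ.< length d
  dihedral {i} {k} i≢k {d} {v} ls pᵢ pₖ with adjacent? i k
  ... | yes adj = let d′ , alt , p , le = normalize-adjacent adj ls in go alt p le
    where
    transfer : ∀ {d′ x} → d ≈ d′ → depth (d′ ++ v) i ≡ x → 0ℤ ℤ.< x → Positive (d ++ v) i
    transfer p eq = ≡.subst (0ℤ ℤ.<_) (≡.sym (≡.trans (depth-≈ (++-cong p (refl {u = v})) i) eq))
    go : ∀ {d′} → Alternating i k d′ → d ≈ d′ → length d′ ≤ length d →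
      Positive (d ++ v) i ⊎ ∃[ d′ ] d ≈ i ∷ d′ × length d′ ℕ.< length d
    go ⟨⟩ p _ = inj₁ (transfer p refl pᵢ)
    go ⟨k⟩ p _ = inj₁ (transfer p (depth-adjacent adj v) (ℤ.+-mono-< pᵢ pₖ))
    go ⟨ki⟩ p _ = inj₁ (transfer p (≡.trans (depth-adjacent adj (i ∷ v))
      (≡.trans (cong₂ _+_ (depth-self i v) (depth-adjacent (adjacent-sym adj) v))
               (lem (depth v i) (depth v k)))) pₖ)
      where
      lem : ∀ x y → - x + (y + x) ≡ y
      lem = solve-∀
    go ⟨i⟩ p le = inj₂ (_ , p , le)
    go ⟨ik⟩ p le = inj₂ (_ , p , le)
    go ⟨iki⟩ p le = inj₂ (_ , p , le)
  ... | no ¬adj = let d′ , com , p , le = normalize-far ¬adj ls in go com p le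
    where
    transfer : ∀ {d′ x} → d ≈ d′ → depth (d′ ++ v) i ≡ x → 0ℤ ℤ.< x → Positive (d ++ v) i
    transfer p eq = ≡.subst (0ℤ ℤ.<_) (≡.sym (≡.trans (depth-≈ (++-cong p (refl {u = v})) i) eq))
    go : ∀ {d′} → Commuting i k d′ → d ≈ d′ → length d′ ≤ length d →
      Positive (d ++ v) i ⊎ ∃[ d′ ] d ≈ i ∷ d′ × length d′ ℕ.< length d
    go ⟨⟩ p _ = inj₁ (transfer p refl pᵢ)
    go ⟨k⟩ p _ = inj₁ (transfer p (depth-far i≢k ¬adj v) pᵢ)
    go ⟨i⟩ p le = inj₂ (_ , p , le)
    go ⟨ik⟩ p le = inj₂ (_ , p , le)

  -- A coset decomposition for ⟨sᵢ, sₖ⟩: the two positivity conditions say that v cannot be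
  -- shortened from the left by either letter.
  Decomposition : Fin n → Fin n → Word n → Set
  Decomposition i k u = ∃[ d ] ∃[ v ] All (IsLetter i k) d × u ≈ d ++ v ×
    length d ℕ.+ length v ≤ length u × Positive v i × Positive v k

  -- While the dichotomy finds a leading i or k, that letter is moved into d. The bound c decreases
  -- and drives the recursion, while b stays fixed so that the given dichotomy remains applicable.
  decompose : ∀ {b} → (∀ w → length w ≤ b → ∀ i → Dichotomy w i) →
    ∀ i k u → length u ≤ b → Decomposition i k u
  decompose {b} dichotomy i k u u≤b = go b u u≤b u≤b
    where
    go : ∀ c u → length u ≤ c → length u ≤ b → Decomposition i k u
    peel : ∀ c {l u u′} → IsLetter i k l → u ≈ l ∷ u′ → length u′ ℕ.< length u →
      length u ≤ c → length u ≤ b → Decomposition i k u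
    peel zero _ _ lt u≤c = contradiction (ℕ.<-≤-trans lt u≤c) λ ()
    peel (suc c) {l} {u} {u′} l∈ p lt u≤c u≤b =
      let d , v , ls , q , le , pos = go c u′ (ℕ.s≤s⁻¹ (ℕ.≤-trans lt u≤c)) (ℕ.≤-trans (ℕ.<⇒≤ lt) u≤b)
      in l ∷ d , v , l∈ ∷ ls , trans p (∷-cong l q) , ℕ.≤-trans (s≤s le) lt , pos
    go c u u≤c u≤b with dichotomy u u≤b i | dichotomy u u≤b k
    ... | inj₁ pᵢ | inj₁ pₖ = [] , u , [] , refl , ℕ.≤-refl , pᵢ , pₖ
    ... | inj₂ (u′ , p , lt) | _ = peel c (inj₁ refl) p lt u≤c u≤b
    ... | inj₁ _ | inj₂ (u′ , p , lt) = peel c (inj₂ refl) p lt u≤c u≤b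

  -- If the first letter k differs from i, the induction hypothesis splits the tail as d v. Then
  -- `k ∷ d` is still a word in i and k, so the question is settled inside the dihedral group.
  dichotomy : ∀ b w → length w ≤ b → ∀ i → Dichotomy w i
  dichotomy b [] _ i = inj₁ (≡.subst (0ℤ ℤ.<_) (≡.sym (depth-[] i)) (ℤ.+<+ (s≤s z≤n)))
  dichotomy (suc b) (k ∷ u) (s≤s u≤b) i with i Fin.≟ k
  ... | yes refl = inj₂ (u , refl , ℕ.≤-refl)
  ... | no i≢k with decompose (dichotomy b) i k u u≤b
  ... | d , v , ls , u≈dv , le , pᵢ , pₖ with dihedral i≢k {k ∷ d} {v} (inj₂ refl ∷ ls) pᵢ pₖ
  ... | inj₁ pos = inj₁ (≡.subst (0ℤ ℤ.<_) (≡.sym (depth-≈ (∷-cong k u≈dv) i)) pos)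
  ... | inj₂ (d′ , p , lt) = inj₂ (d′ ++ v , trans (∷-cong k u≈dv) (++-cong p (refl {u = v})) , (begin-strict
      length (d′ ++ v)          ≡⟨ length-++ d′ ⟩
      length d′ ℕ.+ length v    <⟨ ℕ.+-monoˡ-< (length v) lt ⟩
      suc (length d ℕ.+ length v) ≤⟨ s≤s le ⟩
      suc (length u) ∎))
    where open ℕ.≤-Reasoning

  -- If `i ∷ u` has all depths 1, then `depth u i` is -1. The dichotomy therefore yields a leading i
  -- in u, which cancels against the first letter and leaves a shorter word with the same depths.
  fixes-base⇒≈[] : ∀ b w → length w ≤ b → (∀ i → depth w i ≡ 1ℤ) → w ≈ []
  fixes-base⇒≈[] b [] _ _ = refl
  fixes-base⇒≈[] (suc b) (i ∷ u) (s≤s u≤b) eq with dichotomy b u u≤b i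
  ... | inj₁ pos = contradiction (≡.subst (0ℤ ℤ.<_) -depth pos) λ ()
    where
    -depth : depth u i ≡ - 1ℤ
    -depth = ≡.trans (≡.sym (ℤ.neg-involutive (depth u i)))
                     (cong -_ (≡.trans (≡.sym (depth-self i u)) (eq i)))
  ... | inj₂ (w′ , p , lt) = trans iu≈w′ (fixes-base⇒≈[] b w′ (ℕ.≤-trans (ℕ.<⇒≤ lt) u≤b)
                               (λ j → ≡.trans (≡.sym (depth-≈ iu≈w′ j)) (eq j)))
    where
    iu≈w′ : i ∷ u ≈ w′
    iu≈w′ = trans (∷-cong i p) (cancel i w′)

  reverse-inverseˡ : ∀ (w : Word n) → reverse w ++ w ≈ []
  reverse-inverseˡ [] = refl
  reverse-inverseˡ (i ∷ w) = begin
    reverse (i ∷ w) ++ i ∷ w        ≡⟨ cong (_++ i ∷ w) (unfold-reverse i w) ⟩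
    (reverse w ++ i ∷ []) ++ i ∷ w  ≡⟨ ++-assoc (reverse w) (i ∷ []) (i ∷ w) ⟩
    reverse w ++ (i ∷ i ∷ w)        ≈⟨ ++-cong (refl {u = reverse w}) (cancel i w) ⟩
    reverse w ++ w                  ≈⟨ reverse-inverseˡ w ⟩
    [] ∎
    where open ≈-Reasoning

  reverse-inverseʳ : ∀ (w : Word n) → w ++ reverse w ≈ []
  reverse-inverseʳ w = ≡.subst (λ v → v ++ reverse w ≈ []) (reverse-involutive w) (reverse-inverseˡ (reverse w))

  cancel-reverse : ∀ (u w : Word n) → u ++ reverse u ++ w ≈ w
  cancel-reverse u w = ≡.subst (_≈ w) (++-assoc u (reverse u) w) (++-cong (reverse-inverseʳ u) (refl {u = w}))

  trivial⇒≈[] : ∀ w → (∀ k → perm w k ≡ k) → (∀ k → shift w k ≡ 0ℤ) → w ≈ []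
  trivial⇒≈[] w perm≡ shift≡ = fixes-base⇒≈[] (length w) w ℕ.≤-refl
    (λ i → ≡.trans (height-cong (ℤ.+ n) same i) (depth-[] i))
    where
    same : move (ℤ.+ n) w base ≗ move (ℤ.+ n) [] base
    same k = cong₂ (λ l c → base l + ℤ.+ n * c) (perm≡ k) (shift≡ k)

  faithful : ∀ u w → perm u ≗ perm w → shift u ≗ shift w → u ≈ w
  faithful u w perm≡ shift≡ = begin
    u                       ≈⟨ cancel-reverse w u ⟨
    w ++ (reverse w ++ u)   ≈⟨ ++-cong (refl {u = w}) (trivial⇒≈[] (reverse w ++ u) perm-id shift-0) ⟩
    w ++ []                 ≡⟨ ++-identityʳ w ⟩
    w ∎
    where
    open ≈-Reasoning
    perm-id : ∀ k → perm (reverse w ++ u) k ≡ k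
    perm-id k = ≡.trans (perm-++ (reverse w) u k) (≡.trans (perm≡ _)
      (≡.trans (≡.sym (perm-++ (reverse w) w k)) (perm-≈ (reverse-inverseˡ w) k)))
    shift-0 : ∀ k → shift (reverse w ++ u) k ≡ 0ℤ
    shift-0 k = ≡.trans (shift-++ (reverse w) u k) (≡.trans (cong (_+ shift (reverse w) k) (shift≡ _))
      (≡.trans (≡.sym (shift-++ (reverse w) w k)) (shift-≈ (reverse-inverseˡ w) k)))

  -- The action over an arbitrary coordinate ring

  module Scalars {c ℓ} (K : CommutativeRing c ℓ) where

    open CommutativeRing K
      using ( 0#; 1#; setoid; +-monoid; +-group; +-abelianGroup; +-cong; +-congˡ; +-congʳ
            ; +-assoc; +-identityˡ; +-identityʳ; +-comm; -‿cong; -‿inverseʳ )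
      renaming ( _≈_ to _≈ᴷ_; _+_ to _+ᴷ_; _-_ to _-ᴷ_; -_ to -ᴷ_; refl to ≈ᴷ-refl
               ; sym to ≈ᴷ-sym; trans to ≈ᴷ-trans; reflexive to ≈ᴷ-reflexive )
    open MonoidMult +-monoid using (×-homo-+) renaming (_×_ to _×ᴷ_)
    open GroupProperties +-group using (ε⁻¹≈ε; ⁻¹-injective; inverseʳ-unique; ∙-cancelʳ; ∙-cancelˡ)
    open AbelianGroupProperties +-abelianGroup using (⁻¹-∙-comm)
    open MonoidSum +-monoid using () renaming (sum to sumᴷ; sum-replicate-zero to sumᴷ-replicate-zero)
    open SetoidReasoning setoid

    fromℤ-⊖ : ∀ a b → fromℤ K (a ℤ.⊖ b) ≈ᴷ a ×ᴷ 1# -ᴷ b ×ᴷ 1#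
    fromℤ-⊖ a zero = ≈ᴷ-sym (≈ᴷ-trans (+-congˡ ε⁻¹≈ε) (+-identityʳ _))
    fromℤ-⊖ zero (suc b) = ≈ᴷ-sym (+-identityˡ _)
    fromℤ-⊖ (suc a) (suc b) = begin
      fromℤ K (suc a ℤ.⊖ suc b)             ≡⟨ cong (fromℤ K) (ℤ.[1+m]⊖[1+n]≡m⊖n a b) ⟩
      fromℤ K (a ℤ.⊖ b)                     ≈⟨ fromℤ-⊖ a b ⟩
      x -ᴷ y                                ≈⟨ +-congʳ (+-identityʳ x) ⟨
      (x +ᴷ 0#) -ᴷ y                        ≈⟨ +-congʳ (+-congˡ (-‿inverseʳ 1#)) ⟨
      (x +ᴷ (1# -ᴷ 1#)) -ᴷ y                ≈⟨ +-congʳ (+-assoc x 1# (-ᴷ 1#)) ⟨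
      ((x +ᴷ 1#) -ᴷ 1#) -ᴷ y                ≈⟨ +-congʳ (+-congʳ (+-comm x 1#)) ⟩
      ((1# +ᴷ x) -ᴷ 1#) -ᴷ y                ≈⟨ +-assoc _ _ _ ⟩
      (1# +ᴷ x) +ᴷ (-ᴷ 1# -ᴷ y)             ≈⟨ +-congˡ (⁻¹-∙-comm 1# y) ⟩
      (1# +ᴷ x) -ᴷ (1# +ᴷ y)                ∎
      where
      x = a ×ᴷ 1#
      y = b ×ᴷ 1#

    fromℤ-+ : ∀ x y → fromℤ K (x + y) ≈ᴷ fromℤ K x +ᴷ fromℤ K y
    fromℤ-+ (ℤ.+ a) (ℤ.+ b) = ×-homo-+ 1# a b
    fromℤ-+ (ℤ.+ a) -[1+ b ] = fromℤ-⊖ a (suc b)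
    fromℤ-+ -[1+ a ] (ℤ.+ b) = ≈ᴷ-trans (fromℤ-⊖ b (suc a)) (+-comm _ _)
    fromℤ-+ -[1+ a ] -[1+ b ] = begin
      -ᴷ (suc (suc (a ℕ.+ b)) ×ᴷ 1#)          ≡⟨ cong (λ k → -ᴷ (suc k ×ᴷ 1#)) (ℕ.+-suc a b) ⟨
      -ᴷ ((suc a ℕ.+ suc b) ×ᴷ 1#)            ≈⟨ -‿cong (×-homo-+ 1# (suc a) (suc b)) ⟩
      -ᴷ (suc a ×ᴷ 1# +ᴷ suc b ×ᴷ 1#)         ≈⟨ ⁻¹-∙-comm _ _ ⟨
      -ᴷ (suc a ×ᴷ 1#) -ᴷ suc b ×ᴷ 1#         ∎

    fromℤ-neg : ∀ x → fromℤ K (- x) ≈ᴷ -ᴷ fromℤ K x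
    fromℤ-neg x = inverseʳ-unique _ _ (≈ᴷ-trans (≈ᴷ-sym (fromℤ-+ x (- x)))
                                               (≈ᴷ-reflexive (cong (fromℤ K) (ℤ.+-inverseʳ x))))

    fromℤ-sum : ∀ {m} (x : Vector ℤ m) → sumᴷ (fromℤ K ∘ x) ≈ᴷ fromℤ K (sum x)
    fromℤ-sum {zero} x = ≈ᴷ-refl
    fromℤ-sum {suc m} x = ≈ᴷ-trans (+-congˡ (fromℤ-sum (x ∘ suc))) (≈ᴷ-sym (fromℤ-+ (x zero) _))

    actGen-formula : ∀ j v k → actGen K j v k ≈ᴷ v (permGen j k) +ᴷ fromℤ K (shiftGen j k)
    -- The update at `lastIx` is the outer one in `actGen`, so that position is split off first.
    actGen-formula zero v k with k Fin.≟ lastIx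
    ... | yes refl = begin
      updateAt (updateAt v firstIx _) lastIx (const (v firstIx -ᴷ 1#)) lastIx
        ≡⟨ updateAt-updates lastIx (updateAt v firstIx _) ⟩
      v firstIx -ᴷ 1#               ≈⟨ +-congˡ (-‿cong (+-identityʳ 1#)) ⟨
      v firstIx +ᴷ fromℤ K (- 1ℤ)
        ≡⟨ cong (λ x → v firstIx +ᴷ fromℤ K x) shift-last ⟨
      v firstIx +ᴷ fromℤ K (shiftGen zero lastIx) ∎
      where
      shift-last : shiftGen zero lastIx ≡ - 1ℤ
      shift-last = cong₂ (λ a b → - (1ℤ * (a - b))) (e-refl (lastIx {n})) (e-≢ (prev≢ zero ∘ ≡.sym))
    ... | no k≢last with k
    ...   | zero = begin
      updateAt (updateAt v firstIx (const (v lastIx +ᴷ 1#))) lastIx (const (v firstIx -ᴷ 1#)) zero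
        ≡⟨ updateAt-minimal zero lastIx (updateAt v firstIx _) (prev≢ zero ∘ ≡.sym) ⟩
      v lastIx +ᴷ 1#                      ≈⟨ +-congˡ (+-identityʳ 1#) ⟨
      v lastIx +ᴷ fromℤ K 1ℤ
        ≡⟨ cong (λ x → v lastIx +ᴷ fromℤ K (- (1ℤ * (x - 1ℤ)))) (e-≢ (prev≢ zero)) ⟨
      v lastIx +ᴷ fromℤ K (shiftGen zero zero) ∎
    ...   | suc k = begin
      updateAt (updateAt v firstIx (const (v lastIx +ᴷ 1#))) lastIx (const (v firstIx -ᴷ 1#)) (suc k)
        ≡⟨ updateAt-minimal (suc k) lastIx (updateAt v firstIx _) k≢last ⟩
      v (suc k)                          ≈⟨ +-identityʳ _ ⟨
      v (suc k) +ᴷ fromℤ K 0ℤ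
        ≡⟨ cong (λ x → v (suc k) +ᴷ fromℤ K (- (1ℤ * (x - 0ℤ)))) (e-≢ {i = lastIx} (k≢last ∘ ≡.sym)) ⟨
      v (suc k) +ᴷ fromℤ K (shiftGen zero (suc k)) ∎
    actGen-formula (suc i) v k = begin
      v (permGen (suc i) k) ≈⟨ +-identityʳ _ ⟨
      v (permGen (suc i) k) +ᴷ fromℤ K 0ℤ
        ≡⟨ cong (λ x → v (permGen (suc i) k) +ᴷ fromℤ K (- x)) (ℤ.*-zeroˡ (coroot (suc i) k)) ⟨
      v (permGen (suc i) k) +ᴷ fromℤ K (shiftGen (suc i) k) ∎

    act-formula : ∀ w v k → act K w v k ≈ᴷ v (perm w k) +ᴷ fromℤ K (shift w k)
    act-formula [] v k = ≈ᴷ-sym (+-identityʳ (v k))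
    act-formula (j ∷ w) v k = begin
      actGen K j (act K w v) k                              ≈⟨ actGen-formula j (act K w v) k ⟩
      act K w v (permGen j k) +ᴷ fromℤ K (shiftGen j k)     ≈⟨ +-congʳ (act-formula w v (permGen j k)) ⟩
      v (perm w (permGen j k)) +ᴷ fromℤ K (shift w (permGen j k)) +ᴷ fromℤ K (shiftGen j k)
        ≈⟨ +-assoc _ _ _ ⟩
      v (perm w (permGen j k)) +ᴷ (fromℤ K (shift w (permGen j k)) +ᴷ fromℤ K (shiftGen j k))
        ≈⟨ +-congˡ (fromℤ-+ (shift w (permGen j k)) (shiftGen j k)) ⟨
      v (perm (j ∷ w) k) +ᴷ fromℤ K (shift (j ∷ w) k)       ∎

    isTranslation : ∀ {x w} → (∀ k → perm w k ≡ k) → shift w ≗ x → IsTranslation K x w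
    isTranslation {w = w} perm≡ shift≡ v _ k = ≈ᴷ-trans (act-formula w v k)
      (≈ᴷ-reflexive (cong₂ (λ l c → v l +ᴷ fromℤ K c) (perm≡ k) (shift≡ k)))

    module _ (char0 : CharacteristicZero K) where

      fromℤ-kernel : ∀ x → fromℤ K x ≈ᴷ 0# → x ≡ 0ℤ
      fromℤ-kernel (ℤ.+ a) eq = cong ℤ.+_ (char0 a eq)
      fromℤ-kernel -[1+ a ] eq = contradiction
        (char0 (suc a) (⁻¹-injective (≈ᴷ-trans eq (≈ᴷ-sym ε⁻¹≈ε)))) λ ()

      fromℤ-injective : ∀ x y → fromℤ K x ≈ᴷ fromℤ K y → x ≡ y
      fromℤ-injective x y eq = ℤ.i-j≡0⇒i≡j x y (fromℤ-kernel (x - y) (begin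
        fromℤ K (x - y)             ≈⟨ fromℤ-+ x (- y) ⟩
        fromℤ K x +ᴷ fromℤ K (- y)  ≈⟨ +-cong eq (fromℤ-neg y) ⟩
        fromℤ K y -ᴷ fromℤ K y      ≈⟨ -‿inverseʳ _ ⟩
        0# ∎))

      translation-shift : ∀ x w → IsTranslation K x w → shift w ≗ x
      translation-shift x w tr k = fromℤ-injective _ _ (∙-cancelˡ 0# _ _ (begin
        0# +ᴷ fromℤ K (shift w k)   ≈⟨ act-formula w (const 0#) k ⟨
        act K w (const 0#) k        ≈⟨ tr (const 0#) (sumᴷ-replicate-zero n) k ⟩
        0# +ᴷ fromℤ K (x k) ∎))

      -- `IsTranslation` speaks only of vectors with coordinate sum zero, so a single unit vector
      -- cannot be the test. With e_k - e_k′ the entries at k and k′ are 1 and -1, which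
      -- characteristic zero keeps apart.
      translation-perm : ∀ x w → IsTranslation K x w → ∀ k → perm w k ≡ k
      translation-perm x w tr k with perm w k Fin.≟ k
      ... | yes eq = eq
      ... | no k′≢k = contradiction (≡.trans (≡.sym v-k′) (≡.trans v-eq v-k)) λ ()
        where
        k′ = perm w k
        v : Vector ℤ n
        v = e k ⊖ e k′
        v-k : v k ≡ 1ℤ
        v-k = cong₂ _-_ (e-refl k) (e-≢ k′≢k)
        v-k′ : v k′ ≡ - 1ℤ
        v-k′ = cong₂ _-_ (e-≢ (k′≢k ∘ ≡.sym)) (e-refl k′)
        v∈V : InV K (fromℤ K ∘ v)
        v∈V = ≈ᴷ-trans (fromℤ-sum v) (≈ᴷ-reflexive (cong (fromℤ K)
          (≡.trans (sum-minus (e k) (e k′)) (cong₂ _-_ (sum-e-total k) (sum-e-total k′)))))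
        v-eq : v k′ ≡ v k
        v-eq = fromℤ-injective _ _ (∙-cancelʳ (fromℤ K (shift w k)) _ _ (begin
          fromℤ K (v k′) +ᴷ fromℤ K (shift w k) ≈⟨ act-formula w (fromℤ K ∘ v) k ⟨
          act K w (fromℤ K ∘ v) k               ≈⟨ tr (fromℤ K ∘ v) v∈V k ⟩
          fromℤ K (v k) +ᴷ fromℤ K (x k)
            ≡⟨ cong (λ c → fromℤ K (v k) +ᴷ fromℤ K c) (translation-shift x w tr k) ⟨
          fromℤ K (v k) +ᴷ fromℤ K (shift w k)  ∎))

  -- The level-zero action

  perm-reverseˡ : ∀ w k → perm w (perm (reverse w) k) ≡ k
  perm-reverseˡ w k = ≡.trans (≡.sym (perm-++ (reverse w) w k)) (perm-≈ (reverse-inverseˡ w) k)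

  perm-reverseʳ : ∀ w k → perm (reverse w) (perm w k) ≡ k
  perm-reverseʳ w k = ≡.trans (≡.sym (perm-++ w (reverse w) k)) (perm-≈ (reverse-inverseʳ w) k)

  perm-injective : ∀ w {i j} → perm w i ≡ perm w j → i ≡ j
  perm-injective w {i} {j} eq =
    ≡.trans (≡.sym (perm-reverseʳ w i)) (≡.trans (cong (perm (reverse w)) eq) (perm-reverseʳ w j))

  e-perm : ∀ w i k → e (perm w i) (perm w k) ≡ e i k
  e-perm w i k with i Fin.≟ k
  ... | yes refl = e-refl (perm w i)
  ... | no i≢k = e-≢ (i≢k ∘ perm-injective w)

  permGen-involutive : ∀ j k → permGen j (permGen j k) ≡ k
  permGen-involutive j = perm-≈ (square j)

  permGen-prev : ∀ j → permGen j (prev j) ≡ j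
  permGen-prev j rewrite dec-true (prev j Fin.≟ prev j) refl = refl

  permGen-self : ∀ j → permGen j j ≡ prev j
  permGen-self j = ≡.trans (cong (permGen j) (≡.sym (permGen-prev j))) (permGen-involutive j (prev j))

  e-permGen : ∀ j i k → e (permGen j i) k ≡ e i (permGen j k)
  e-permGen j i k = ≡.trans (cong (e (permGen j i)) (≡.sym (permGen-involutive j k)))
                            (e-perm (j ∷ []) i (permGen j k))

  e-prev : ∀ i q → e (prev i) q ≡ e i (next q)
  e-prev i q with prev i Fin.≟ q
  ... | yes refl = ≡.sym (≡.trans (cong (e i) (next-prev i)) (e-refl i))
  ... | no p = ≡.sym (e-≢ {i = i} {next q} (λ eq → p (≡.trans (cong prev eq) (prev-next q))))

  simpleFinitePart-coroot : ∀ i q → simpleFinitePart i q ≡ coroot i q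
  simpleFinitePart-coroot zero q = lem (e zero q) (e lastIx q)
    where
    lem : ∀ a b → - (a - b) ≡ b - a
    lem = solve-∀
  simpleFinitePart-coroot (suc i) q = refl

  -- Position q has entry 1 in `coroot (next q)`, entry -1 in `coroot q`, and 0 in all others, so
  -- the finite part is a cyclic difference of coefficients.
  finitePart-diff : ∀ β q → finitePart β q ≡ β (next q) - β q
  finitePart-diff β q = begin
    sum (λ i → β i * simpleFinitePart i q)
      ≡⟨ sum-cong-≗ (λ i → ≡.trans (cong (β i *_)
           (≡.trans (simpleFinitePart-coroot i q) (cong (_- e i q) (e-prev i q))))
           (*-distribˡ-minus (β i) (e i (next q)) (e i q))) ⟩
    sum (λ i → β i * e i (next q) - β i * e i q)
      ≡⟨ sum-minus (λ i → β i * e i (next q)) (λ i → β i * e i q) ⟩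
    sum (λ i → β i * e i (next q)) - sum (λ i → β i * e i q)
      ≡⟨ cong₂ _-_ (sum-e β (next q)) (sum-e β q) ⟩
    β (next q) - β q ∎
    where
    open ≡.≡-Reasoning

  reflectSimple-cartan : ∀ j i k → reflectSimple j i k ≡ e i k - cartan i j * e j k
  reflectSimple-cartan j i k with i Fin.≟ j
  ... | yes refl = ≡.sym (≡.trans (cong (λ c → e i k - c * e i k) (cartan-self i)) (lem (e i k)))
    where
    lem : ∀ x → x - ℤ.+ 2 * x ≡ - x
    lem = solve-∀
  ... | no i≢j with adjacent? i j
  ... | yes adj = ≡.trans (cong (λ b → (if b then e i ⊕ e j else e i) k) (dec-true (adjacent? i j) adj))
    (≡.sym (≡.trans (cong (λ c → e i k - c * e j k) (cartan-adjacent adj)) (lem (e i k) (e j k))))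
    where
    lem : ∀ x y → x - - 1ℤ * y ≡ x + y
    lem = solve-∀
  ... | no ¬adj = ≡.trans (cong (λ b → (if b then e i ⊕ e j else e i) k) (dec-false (adjacent? i j) ¬adj))
    (≡.sym (≡.trans (cong (λ c → e i k - c * e j k) (cartan-far i≢j ¬adj)) (lem (e i k) (e j k))))
    where
    lem : ∀ x y → x - 0ℤ * y ≡ x
    lem = solve-∀

  cartan-transpose : ∀ i j → cartan i j ≡ coroot i (prev j) - coroot i j
  cartan-transpose i j = ≡.trans
    (cong₂ _-_ (cong₂ _-_ (e-sym (prev j) (prev i)) (e-sym j (prev i)))
              (cong₂ _-_ (e-sym (prev j) i) (e-sym j i)))
    (lem (e (prev i) (prev j)) (e (prev i) j) (e i (prev j)) (e i j))
    where
    lem : ∀ a b c d → a - b - (c - d) ≡ a - c - (b - d)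
    lem = solve-∀

  pairing : Fin n → AffLattice n → ℤ
  pairing j β = finitePart β (prev j) - finitePart β j

  sum-cartan : ∀ j β → sum (λ i → β i * cartan i j) ≡ pairing j β
  sum-cartan j β = ≡.trans
    (sum-cong-≗ (λ i → ≡.trans (cong (β i *_) (≡.trans (cartan-transpose i j)
        (≡.sym (cong₂ _-_ (simpleFinitePart-coroot i (prev j)) (simpleFinitePart-coroot i j)))))
      (*-distribˡ-minus (β i) (simpleFinitePart i (prev j)) (simpleFinitePart i j))))
    (sum-minus (λ i → β i * simpleFinitePart i (prev j)) (λ i → β i * simpleFinitePart i j))

  reflect-formula : ∀ j β k → reflect j β k ≡ β k - pairing j β * e j k
  reflect-formula j β k = begin
    sum (λ i → β i * reflectSimple j i k)
      ≡⟨ sum-cong-≗ (λ i → ≡.trans (cong (β i *_) (reflectSimple-cartan j i k))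
           (lem (β i) (e i k) (cartan i j) (e j k))) ⟩
    sum (λ i → β i * e i k - β i * cartan i j * e j k)
      ≡⟨ sum-minus (λ i → β i * e i k) (λ i → β i * cartan i j * e j k) ⟩
    sum (λ i → β i * e i k) - sum (λ i → β i * cartan i j * e j k)
      ≡⟨ cong₂ _-_ (sum-e β k) (sum-*ʳ (λ i → β i * cartan i j) (e j k)) ⟩
    β k - sum (λ i → β i * cartan i j) * e j k
      ≡⟨ cong (λ p → β k - p * e j k) (sum-cartan j β) ⟩
    β k - pairing j β * e j k ∎
    where
    open ≡.≡-Reasoning
    lem : ∀ x a c b → x * (a - c * b) ≡ x * a - x * c * b
    lem = solve-∀

  finitePart-reflect : ∀ j β q → finitePart (reflect j β) q ≡ finitePart β (permGen j q)
  finitePart-reflect j β q = begin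
    finitePart (reflect j β) q ≡⟨ finitePart-diff (reflect j β) q ⟩
    reflect j β (next q) - reflect j β q
      ≡⟨ cong₂ _-_ (reflect-formula j β (next q)) (reflect-formula j β q) ⟩
    β (next q) - p * e j (next q) - (β q - p * e j q)
      ≡⟨ lem (β (next q)) (β q) p (e j (next q)) (e j q) ⟩
    β (next q) - β q - p * (e j (next q) - e j q)
      ≡⟨ cong₂ (λ x y → x - p * (y - e j q)) (finitePart-diff β q) (e-prev j q) ⟨
    finitePart β q - p * coroot j q
      ≡⟨ transpose-at (prev≢ j) (finitePart β) q ⟨
    finitePart β (permGen j q) ∎
    where
    open ≡.≡-Reasoning
    p = pairing j β
    lem : ∀ x y p a b → x - p * a - (y - p * b) ≡ x - y - p * (a - b)
    lem = solve-∀

  finitePart-levelZero : ∀ w β q → finitePart (levelZero w β) q ≡ finitePart β (perm w q)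
  finitePart-levelZero [] β q = refl
  finitePart-levelZero (j ∷ w) β q = ≡.trans (finitePart-reflect j (levelZero w β) q)
                                             (finitePart-levelZero w β (permGen j q))

  finitePart-root : ∀ w β {i j} → finitePart β ≗ e (perm w i) ⊖ e (perm w j) →
    finitePart (levelZero w β) ≗ e i ⊖ e j
  finitePart-root w β {i} {j} fin q = ≡.trans (finitePart-levelZero w β q)
    (≡.trans (fin (perm w q)) (cong₂ _-_ (e-perm w i q) (e-perm w j q)))

  -- The rule t_λ(α + pδ) = α + (p - ⟨λ, α⟩)δ, extended to all words. As `perm w` pulls positions
  -- back, the root that lands on (i, j) starts at (`perm w i`, `perm w j`).
  δ-coeff-levelZero : ∀ w β {i j} → finitePart β ≗ e (perm w i) ⊖ e (perm w j) →
    δ-coeff (levelZero w β) ≡ δ-coeff β - shift w i + shift w j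
  δ-coeff-levelZero [] β fin = lem (β zero)
    where
    lem : ∀ x → x ≡ x - 0ℤ + 0ℤ
    lem = solve-∀
  δ-coeff-levelZero (g ∷ w) β {i} {j} fin = begin
    reflect g γ zero                    ≡⟨ reflect-formula g γ zero ⟩
    γ zero - pairing g γ * z            ≡⟨ cong₂ (λ x y → x - y * z) (δ-coeff-levelZero w β fin) pairing-γ ⟩
    β zero - a + b - (coroot g j - coroot g i) * z
                                        ≡⟨ lem (β zero) a b z (coroot g i) (coroot g j) ⟩
    β zero - (a + shiftGen g i) + (b + shiftGen g j) ∎
    where
    open ≡.≡-Reasoning
    γ = levelZero w β
    z = e g zero
    a = shift w (permGen g i)
    b = shift w (permGen g j)
    at : ∀ l q → e (permGen g l) q ≡ e (permGen g q) l
    at l q = ≡.trans (e-permGen g l q) (e-sym l (permGen g q))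
    γ-at : ∀ q → finitePart γ q ≡ e (permGen g q) i - e (permGen g q) j
    γ-at q = ≡.trans (finitePart-root w β fin q) (cong₂ _-_ (at i q) (at j q))
    pairing-γ : pairing g γ ≡ coroot g j - coroot g i
    pairing-γ = ≡.trans (cong₂ _-_
        (≡.trans (γ-at (prev g)) (cong (λ l → e l i - e l j) (permGen-prev g)))
        (≡.trans (γ-at g) (cong (λ l → e l i - e l j) (permGen-self g))))
      (lem′ (e g i) (e g j) (e (prev g) i) (e (prev g) j))
      where
      lem′ : ∀ a b c d → a - b - (c - d) ≡ d - b - (c - a)
      lem′ = solve-∀
    lem : ∀ x a b z r s → x - a + b - (s - r) * z ≡ x - (a + - (z * r)) + (b + - (z * s))
    lem = solve-∀

  -- Affine roots expanded in simple roots.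

  below : Fin n → Fin n → ℤ
  below i q = if does (toℕ i ℕ.<? toℕ q) then 1ℤ else 0ℤ

  below-< : ∀ {i q} → toℕ i ℕ.< toℕ q → below i q ≡ 1ℤ
  below-< {i} {q} lt = cong (if_then 1ℤ else 0ℤ) (dec-true (toℕ i ℕ.<? toℕ q) lt)

  below-≮ : ∀ {i q} → ¬ (toℕ i ℕ.< toℕ q) → below i q ≡ 0ℤ
  below-≮ {i} {q} ≮ = cong (if_then 1ℤ else 0ℤ) (dec-false (toℕ i ℕ.<? toℕ q) ≮)

  -- `below i` is a discrete antiderivative of `e i` along the cycle, up to the defect c = 1 at the
  -- wrap from n - 1 to 0. That c is independent of i, so it cancels in `below i q - below j q`.
  below-next : ∀ q → ∃[ c ] ∀ i → below i (next q) ≡ below i q + e i q - c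
  below-next q with suc (toℕ q) ℕ.<? n
  ... | yes lt = 0ℤ , λ i → ≡.trans (go i) (≡.sym (ℤ.+-identityʳ _))
    where
    eq = toℕ-next q lt
    go : ∀ i → below i (next q) ≡ below i q + e i q
    go i with ℕ.<-cmp (toℕ i) (toℕ q)
    ... | tri< i<q i≢q _ = ≡.trans (below-< (≡.subst (toℕ i ℕ.<_) (≡.sym eq) (ℕ.m<n⇒m<1+n i<q)))
      (≡.sym (cong₂ _+_ (below-< i<q) (e-≢ (i≢q ∘ cong toℕ))))
    ... | tri≈ i≮q i≡q _ = ≡.trans (below-< (≡.subst (toℕ i ℕ.<_) (≡.sym eq) (s≤s (ℕ.≤-reflexive i≡q))))
      (≡.sym (cong₂ _+_ (below-≮ i≮q) (≡.trans (cong (λ l → e l q) (Fin.toℕ-injective i≡q)) (e-refl q))))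
    ... | tri> i≮q i≢q q<i = ≡.trans
      (below-≮ (λ lt → ℕ.<⇒≱ q<i (ℕ.s≤s⁻¹ (≡.subst (toℕ i ℕ.<_) eq lt))))
      (≡.sym (cong₂ _+_ (below-≮ i≮q) (e-≢ (i≢q ∘ cong toℕ))))
  ... | no ≮ = 1ℤ , go
    where
    q-last : suc (toℕ q) ≡ n
    q-last = ℕ.≤-antisym (Fin.toℕ<n q) (ℕ.≮⇒≥ ≮)
    next≡0 : next q ≡ zero
    next≡0 = next-last q q-last
    go : ∀ i → below i (next q) ≡ below i q + e i q - 1ℤ
    go i with ℕ.m≤n⇒m<n∨m≡n (ℕ.s≤s⁻¹ (≡.subst (toℕ i ℕ.<_) (≡.sym q-last) (Fin.toℕ<n i)))
    ... | inj₁ i<q = ≡.trans (below-≮ (λ lt → ℕ.n≮0 (≡.subst (λ l → toℕ i ℕ.< toℕ l) next≡0 lt)))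
      (≡.sym (cong₂ (λ x y → x + y - 1ℤ) (below-< i<q) (e-≢ (ℕ.<⇒≢ i<q ∘ cong toℕ))))
    ... | inj₂ i≡q = ≡.trans (below-≮ (λ lt → ℕ.n≮0 (≡.subst (λ l → toℕ i ℕ.< toℕ l) next≡0 lt)))
      (≡.sym (cong₂ (λ x y → x + y - 1ℤ) (below-≮ (ℕ.<-irrefl i≡q))
        (≡.trans (cong (λ l → e l q) (Fin.toℕ-injective i≡q)) (e-refl q))))

  -- e i ⊖ e j + p δ, expanded in simple roots.
  affineRoot : Fin n → Fin n → ℤ → AffLattice n
  affineRoot i j p q = p + (below i q - below j q)

  finitePart-affineRoot : ∀ i j p → finitePart (affineRoot i j p) ≗ e i ⊖ e j
  finitePart-affineRoot i j p q = let c , step = below-next q in begin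
    finitePart (affineRoot i j p) q ≡⟨ finitePart-diff (affineRoot i j p) q ⟩
    p + (below i (next q) - below j (next q)) - (p + (below i q - below j q))
      ≡⟨ cong₂ (λ x y → p + (x - y) - (p + (below i q - below j q))) (step i) (step j) ⟩
    p + (below i q + e i q - c - (below j q + e j q - c)) - (p + (below i q - below j q))
      ≡⟨ lem p (below i q) (below j q) (e i q) (e j q) c ⟩
    e i q - e j q ∎
    where
    open ≡.≡-Reasoning
    lem : ∀ p x y a b c → p + (x + a - c - (y + b - c)) - (p + (x - y)) ≡ a - b
    lem = solve-∀

  δ-coeff-affineRoot : ∀ i j p → δ-coeff (affineRoot i j p) ≡ p
  δ-coeff-affineRoot i j p = ≡.trans
    (cong₂ (λ x y → p + (x - y)) (below-≮ {i} {zero} λ ()) (below-≮ {j} {zero} λ ())) (ℤ.+-identityʳ p)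

  root-injective : ∀ {i j k l : Fin n} → i ≢ j → e i ⊖ e j ≗ e k ⊖ e l → i ≡ k × j ≡ l
  root-injective {i} {j} {k} {l} i≢j eq = left , right
    where
    left : i ≡ k
    left with k Fin.≟ i
    ... | yes k≡i = ≡.sym k≡i
    ... | no k≢i = contradiction (≡.trans (≡.sym (cong₂ _-_ (e-refl i) (e-≢ (i≢j ∘ ≡.sym))))
                     (≡.trans (eq i) (cong (_- e l i) (e-≢ k≢i)))) (lem (l Fin.≟ i))
      where
      lem : ∀ (d : Dec (l ≡ i)) → 1ℤ - 0ℤ ≢ 0ℤ - (if does d then 1ℤ else 0ℤ)
      lem (yes _) ()
      lem (no _) ()
    right : j ≡ l
    right with l Fin.≟ j
    ... | yes l≡j = ≡.sym l≡j
    ... | no l≢j = contradiction (≡.trans (≡.sym (cong₂ _-_ (e-≢ i≢j) (e-refl j)))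
                     (≡.trans (eq j) (cong (λ x → e k j - x) (e-≢ l≢j)))) (lem (k Fin.≟ j))
      where
      lem : ∀ (d : Dec (k ≡ j)) → 0ℤ - 1ℤ ≢ (if does d then 1ℤ else 0ℤ) - 0ℤ
      lem (yes _) ()
      lem (no _) ()

  -- e i ⊖ e j + p δ is positive.
  PositiveAt : Fin n → Fin n → ℤ → Set
  PositiveAt i j p = 0ℤ ℤ.< p ⊎ (p ≡ 0ℤ × i Fin.< j)

  PositiveAt-≥0 : ∀ {i j p} → PositiveAt i j p → 0ℤ ℤ.≤ p
  PositiveAt-≥0 (inj₁ 0<p) = ℤ.<⇒≤ 0<p
  PositiveAt-≥0 (inj₂ (p≡0 , _)) = ℤ.≤-reflexive (≡.sym p≡0)

  PositiveAt-> : ∀ {i j p} → toℕ j ≤ toℕ i → PositiveAt i j p → 0ℤ ℤ.< p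
  PositiveAt-> j≤i (inj₁ 0<p) = 0<p
  PositiveAt-> j≤i (inj₂ (_ , i<j)) = contradiction i<j (ℕ.≤⇒≯ j≤i)

  raise : ∀ {i j p q} → 0ℤ ℤ.≤ p → q ≡ 1ℤ + p → PositiveAt i j q
  raise 0≤p refl = inj₁ (ℤ.+-mono-<-≤ (ℤ.+<+ (s≤s z≤n)) 0≤p)

  lower : ∀ {i j p q} → 0ℤ ℤ.< p → q ≡ p - 1ℤ → i Fin.< j → PositiveAt i j q
  lower {p = ℤ.+ suc zero} _ refl i<j = inj₂ (refl , i<j)
  lower {p = ℤ.+ suc (suc p)} _ refl i<j = inj₁ (ℤ.+<+ (s≤s z≤n))
  lower {p = ℤ.+ zero} (ℤ.+<+ ())

  PositiveAt-cong : ∀ {i j k l p q} → (toℕ i ℕ.< toℕ j → toℕ k ℕ.< toℕ l) → q ≡ p →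
    PositiveAt i j p → PositiveAt k l q
  PositiveAt-cong f refl (inj₁ 0<p) = inj₁ 0<p
  PositiveAt-cong f refl (inj₂ (p≡0 , i<j)) = inj₂ (p≡0 , f i<j)

  -- The condition `InS̃ᴾ` read through `δ-coeff-levelZero`. Test roots are indexed by the positions
  -- i, j of their images; as `perm w` is bijective, this reaches every root of R_P.
  PreservesPositive : ℕ → Word n → Set
  PreservesPositive m w = ∀ {i j} → i ≢ j → SameBlock m (perm w i) (perm w j) → ∀ p →
    PositiveAt (perm w i) (perm w j) p → PositiveAt i j (p - shift w i + shift w j)

  S̃ᴾ⇒preserves : ∀ {m} w → InS̃ᴾ m w → PreservesPositive m w
  S̃ᴾ⇒preserves w inS {i} {j} i≢j block p pos =
    conclude (inS β (perm w i , perm w j , (i≢j ∘ perm-injective w , fin , pos′) , block))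
    where
    β = affineRoot (perm w i) (perm w j) p
    fin = finitePart-affineRoot (perm w i) (perm w j) p
    δ≡p = δ-coeff-affineRoot (perm w i) (perm w j) p
    pos′ = ≡.subst (PositiveAt (perm w i) (perm w j)) (≡.sym δ≡p) pos
    conclude : R⁺af (levelZero w β) → PositiveAt i j (p - shift w i + shift w j)
    conclude (a , b , a≢b , fin′ , pos″) =
      -- Positivity is given for unspecified indices a, b; the finite part identifies them with i,
      -- j.
      let a≡i , b≡j = root-injective a≢b (λ q → ≡.trans (≡.sym (fin′ q)) (finitePart-root w β fin q))
      in ≡.subst (PositiveAt i j)
           (≡.trans (δ-coeff-levelZero w β fin) (cong (λ x → x - shift w i + shift w j) δ≡p))
           (≡.subst₂ (λ x y → PositiveAt x y (δ-coeff (levelZero w β))) a≡i b≡j pos″)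

  preserves⇒S̃ᴾ : ∀ {m} w → PreservesPositive m w → InS̃ᴾ m w
  preserves⇒S̃ᴾ {m} w pres β (a , b , (a≢b , fin , pos) , block) =
    i , j , i≢j , finitePart-root w β fin′ ,
    ≡.subst (PositiveAt i j) (≡.sym (δ-coeff-levelZero w β fin′))
      (pres i≢j (≡.subst₂ (SameBlock m) (≡.sym wi≡a) (≡.sym wj≡b) block) (δ-coeff β)
        (≡.subst₂ (λ x y → PositiveAt x y (δ-coeff β)) (≡.sym wi≡a) (≡.sym wj≡b) pos))
    where
    i = perm (reverse w) a
    j = perm (reverse w) b
    wi≡a = perm-reverseˡ w a
    wj≡b = perm-reverseˡ w b
    i≢j : i ≢ j
    i≢j eq = a≢b (≡.trans (≡.sym wi≡a) (≡.trans (cong (perm w) eq) wj≡b))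
    fin′ : finitePart β ≗ e (perm w i) ⊖ e (perm w j)
    fin′ q = ≡.trans (fin q) (cong₂ (λ x y → e x q - e y q) (≡.sym wi≡a) (≡.sym wj≡b))

  -- The two blocks

  -- The case i = j must be covered because it occurs in ξ when a block has a single position, that
  -- is, for m = 1 or m = n - 1.
  InQₚ-block : ∀ {m} {i j : Fin n} → SameBlock m i j → InQₚ m (e i ⊖ e j)
  InQₚ-block {i = i} {j} block with i Fin.≟ j
  ... | no i≢j = root i≢j block
  ... | yes refl = resp (λ k → ≡.sym (ℤ.+-inverseʳ (e i k))) zero

  module _ (m : ℕ) (χ : Fin n → ℤ) (χ-const : ∀ {i j} → SameBlock m i j → χ i ≡ χ j) where

    -- Applied to the indicator of a block, this says that the entries of an element of Q_P sum to
    -- zero there.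
    InQₚ-weight : ∀ {x} → InQₚ m x → sum (λ k → χ k * x k) ≡ 0ℤ
    InQₚ-weight (root {i} {j} _ block) = begin
      sum (λ k → χ k * (e i k - e j k))
        ≡⟨ sum-cong-≗ (λ k → ≡.trans (cong₂ (λ a b → χ k * (a - b)) (e-sym i k) (e-sym j k))
             (*-distribˡ-minus (χ k) (e k i) (e k j))) ⟩
      sum (λ k → χ k * e k i - χ k * e k j)
        ≡⟨ sum-minus (λ k → χ k * e k i) (λ k → χ k * e k j) ⟩
      sum (λ k → χ k * e k i) - sum (λ k → χ k * e k j)
        ≡⟨ cong₂ _-_ (sum-e χ i) (sum-e χ j) ⟩
      χ i - χ j ≡⟨ ℤ.i≡j⇒i-j≡0 (χ-const block) ⟩
      0ℤ ∎
      where
      open ≡.≡-Reasoning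
    InQₚ-weight zero = sum-*0 χ
    InQₚ-weight (add {x} {y} p q) = ≡.trans (sum-cong-≗ (λ k → ℤ.*-distribˡ-+ (χ k) (x k) (y k)))
      (≡.trans (∑-distrib-+ (λ k → χ k * x k) (λ k → χ k * y k))
                (cong₂ _+_ (InQₚ-weight p) (InQₚ-weight q)))
    InQₚ-weight (neg {x} p) = ≡.trans (sum-cong-≗ (λ k → ≡.sym (ℤ.neg-distribʳ-* (χ k) (x k))))
      (≡.trans (sum-neg (λ k → χ k * x k)) (cong -_ (InQₚ-weight p)))
    InQₚ-weight (resp x≗y p) = ≡.trans (sum-cong-≗ (λ k → cong (χ k *_) (≡.sym (x≗y k)))) (InQₚ-weight p)

  -- With a Boolean, lying in the same block becomes an equation, which can be chained through
  -- `perm`.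
  low : ℕ → Fin n → Bool
  low m k = does (toℕ k ℕ.<? m)

  low-true : ∀ {m} k → toℕ k ℕ.< m → low m k ≡ true
  low-true {m} k = dec-true (toℕ k ℕ.<? m)

  low-false : ∀ {m} k → m ≤ toℕ k → low m k ≡ false
  low-false {m} k m≤k = dec-false (toℕ k ℕ.<? m) (ℕ.≤⇒≯ m≤k)

  true-low : ∀ {m} k → low m k ≡ true → toℕ k ℕ.< m
  true-low {m} k eq = ℕ.<ᵇ⇒< (toℕ k) m (≡.subst T (≡.sym eq) _)

  false-low : ∀ {m} k → low m k ≡ false → m ≤ toℕ k
  false-low {m} k eq = ℕ.≮⇒≥ λ lt → contradiction (≡.trans (≡.sym (low-true k lt)) eq) λ ()

  low-const : ∀ {m} {i j} → SameBlock m i j → low m i ≡ low m j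
  low-const {i = i} {j} (inj₁ (p , q)) = ≡.trans (low-true i p) (≡.sym (low-true j q))
  low-const {i = i} {j} (inj₂ (p , q)) = ≡.trans (low-false i p) (≡.sym (low-false j q))

  const-low : ∀ {m} {i j} → low m i ≡ low m j → SameBlock m i j
  const-low {m} {i} {j} eq = go (low m j) refl
    where
    go : ∀ b → low m j ≡ b → SameBlock m i j
    go true  eqⱼ = inj₁ (true-low i (≡.trans eq eqⱼ) , true-low j eqⱼ)
    go false eqⱼ = inj₂ (false-low i (≡.trans eq eqⱼ) , false-low j eqⱼ)

  -- The block B carries nonnegative entries with sum zero; the weight χ annihilates the other
  -- block, about which nothing is assumed.
  InQₚ-nonneg⇒0 : ∀ {m x} B → InQₚ m x →
    (∀ k → low m k ≡ B → 0ℤ ℤ.≤ x k) → ∀ k → low m k ≡ B → x k ≡ 0ℤ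
  InQₚ-nonneg⇒0 {m} {x} B x∈Q x≥0 k k∈B = begin
    x k ≡⟨ ℤ.*-identityˡ (x k) ⟨
    1ℤ * x k
      ≡⟨ cong (λ b → (if b then 1ℤ else 0ℤ) * x k) (dec-true (low m k Bool.≟ B) k∈B) ⟨
    χ (low m k) * x k
      ≡⟨ sum-zero⇒zero (λ k → χ (low m k) * x k) nonneg
           (InQₚ-weight m (χ ∘ low m) (cong χ ∘ low-const) x∈Q) k ⟩
    0ℤ ∎
    where
    open ≡.≡-Reasoning
    χ : Bool → ℤ
    χ l = if does (l Bool.≟ B) then 1ℤ else 0ℤ
    nonneg : ∀ k → 0ℤ ℤ.≤ χ (low m k) * x k
    nonneg k with low m k Bool.≟ B
    ... | yes k∈B = ≡.subst (0ℤ ℤ.≤_) (≡.sym (ℤ.*-identityˡ (x k))) (x≥0 k k∈B)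
    ... | no _ = ℤ.≤-reflexive (≡.sym (ℤ.*-zeroˡ (x k)))

  PreservesBlocks : ℕ → Word n → Set
  PreservesBlocks m w = ∀ k → low m (perm w k) ≡ low m k

  permGen-other : ∀ j k → k ≢ prev j → k ≢ j → permGen j k ≡ k
  permGen-other j k p q with k Fin.≟ prev j
  ... | yes eq = contradiction eq p
  ... | no _ with k Fin.≟ j
  ... | yes eq = contradiction eq q
  ... | no _ = refl

  toℕ-prev-suc : ∀ j → toℕ j ≢ 0 → toℕ j ≡ suc (toℕ (prev j))
  toℕ-prev-suc zero p = contradiction refl p
  toℕ-prev-suc (suc j) _ = cong suc (≡.sym (Fin.toℕ-inject₁ j))

  -- The cut between positions m - 1 and m can separate `prev j` from `j` only at j = m, or at j = 0
  -- through the wrap-around; `InIₚ` excludes both.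
  low-prev : ∀ {m} j → InIₚ m j → low m (prev j) ≡ low m j
  low-prev {m} j (j≢0 , j≢m) = low-const (go (toℕ j ℕ.<? m))
    where
    j≡1+prev = toℕ-prev-suc j j≢0
    go : Dec (toℕ j ℕ.< m) → SameBlock m (prev j) j
    go (yes j<m) = inj₁ (ℕ.≤-trans (ℕ.≤-reflexive (≡.sym j≡1+prev)) (ℕ.<⇒≤ j<m) , j<m)
    go (no j≮m) = inj₂ (ℕ.s≤s⁻¹ (≡.subst (m ℕ.<_) j≡1+prev (ℕ.≤∧≢⇒< m≤j (j≢m ∘ ≡.sym))) , m≤j)
      where m≤j = ℕ.≮⇒≥ j≮m

  low-permGen : ∀ {m} j → InIₚ m j → ∀ k → low m (permGen j k) ≡ low m k
  low-permGen {m} j j∈ k = go (k Fin.≟ prev j) (k Fin.≟ j)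
    where
    go : Dec (k ≡ prev j) → Dec (k ≡ j) → low m (permGen j k) ≡ low m k
    go (yes refl) _ = ≡.trans (cong (low m) (permGen-prev j)) (≡.sym (low-prev j j∈))
    go (no _) (yes refl) = ≡.trans (cong (low m) (permGen-self j)) (low-prev j j∈)
    go (no p) (no q) = cong (low m) (permGen-other j k p q)

  parabolic-blocks : ∀ {m w} → All (InIₚ m) w → PreservesBlocks m w
  parabolic-blocks [] k = refl
  parabolic-blocks {w = j ∷ w} (j∈ ∷ w∈) k = ≡.trans (parabolic-blocks w∈ (permGen j k)) (low-permGen j j∈ k)

  shiftGen-finite : ∀ j k → toℕ j ≢ 0 → shiftGen j k ≡ 0ℤ
  shiftGen-finite j k j≢0 = ≡.trans (cong (λ x → - (x * coroot j k)) (e-≢ {i = j} {zero} (j≢0 ∘ cong toℕ)))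
    (cong -_ (ℤ.*-zeroˡ (coroot j k)))

  parabolic-shift : ∀ {m w} → All (InIₚ m) w → ∀ k → shift w k ≡ 0ℤ
  parabolic-shift [] k = refl
  parabolic-shift {w = j ∷ w} ((j≢0 , _) ∷ w∈) k =
    cong₂ _+_ (parabolic-shift w∈ (permGen j k)) (shiftGen-finite j k j≢0)

  PositiveAt-asym : ∀ {i j p q} → p + q ≡ 0ℤ → PositiveAt i j p → PositiveAt j i q → ⊥
  PositiveAt-asym {p = p} {q} p+q≡0 (inj₁ 0<p) (inj₁ 0<q) = ℤ.<-irrefl (≡.sym p+q≡0) (ℤ.+-mono-< 0<p 0<q)
  PositiveAt-asym {p = p} {q} p+q≡0 (inj₁ 0<p) (inj₂ (refl , _)) =
    ℤ.<-irrefl (≡.sym (≡.trans (≡.sym (ℤ.+-identityʳ p)) p+q≡0)) 0<p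
  PositiveAt-asym {p = p} {q} p+q≡0 (inj₂ (refl , _)) (inj₁ 0<q) =
    ℤ.<-irrefl (≡.sym (≡.trans (≡.sym (ℤ.+-identityˡ q)) p+q≡0)) 0<q
  PositiveAt-asym _ (inj₂ (_ , i<j)) (inj₂ (_ , j<i)) = ℕ.<-asym i<j j<i

  -- Inside a block, positivity of the images of ±(e i ⊖ e j) determines the order
  -- of perm w i and perm w j from shift w alone.
  perm-order : ∀ {m} u w → PreservesPositive m u → PreservesPositive m w →
    PreservesBlocks m u → PreservesBlocks m w → shift u ≗ shift w →
    ∀ {i j} → perm u i Fin.< perm u j → perm w i Fin.< perm w j
  perm-order {m} u w pos-u pos-w block-u block-w shift≡ {i} {j} ui<uj = go (low m i) (low m j) refl refl
    where
    i≢j : i ≢ j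
    i≢j refl = ℕ.<-irrefl refl ui<uj
    lem : ∀ a b → 0ℤ - a + b + (0ℤ - b + a) ≡ 0ℤ
    lem = solve-∀
    in-block : low m i ≡ low m j → perm w i Fin.< perm w j
    in-block same with ℕ.<-cmp (toℕ (perm w i)) (toℕ (perm w j))
    ... | tri< lt _ _ = lt
    ... | tri≈ _ eq _ = contradiction (perm-injective w (Fin.toℕ-injective eq)) i≢j
    ... | tri> _ _ gt = ⊥-elim (PositiveAt-asym {i} {j}
      (≡.trans (cong₂ (λ a b → 0ℤ - a + b + (0ℤ - shift w j + shift w i)) (shift≡ i) (shift≡ j))
               (lem (shift w i) (shift w j)))
      (pos-u i≢j (const-low (≡.trans (block-u i) (≡.trans same (≡.sym (block-u j)))))
             0ℤ (inj₂ (refl , ui<uj)))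
      (pos-w (i≢j ∘ ≡.sym) (const-low (≡.trans (block-w j) (≡.trans (≡.sym same) (≡.sym (block-w i)))))
             0ℤ (inj₂ (refl , gt))))
    go : ∀ a b → low m i ≡ a → low m j ≡ b → perm w i Fin.< perm w j
    go true  true  eqᵢ eqⱼ = in-block (≡.trans eqᵢ (≡.sym eqⱼ))
    go false false eqᵢ eqⱼ = in-block (≡.trans eqᵢ (≡.sym eqⱼ))
    go true  false eqᵢ eqⱼ = ℕ.<-≤-trans
      (true-low {m} _ (≡.trans (block-w i) eqᵢ)) (false-low {m} _ (≡.trans (block-w j) eqⱼ))
    go false true  eqᵢ eqⱼ = contradiction ui<uj (ℕ.<-asym
      (ℕ.<-≤-trans (true-low {m} _ (≡.trans (block-u j) eqⱼ)) (false-low {m} _ (≡.trans (block-u i) eqᵢ))))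

  -- The value b - 1 is attained by `perm u` at some l; there `perm w` is at least b - 1 by
  -- induction, and monotonicity makes it larger at k. Used in both directions, this gives equality
  -- of the permutations.
  perm-≤ : ∀ u w → (∀ {i j} → perm u i Fin.< perm u j → perm w i Fin.< perm w j) →
    ∀ b k → toℕ (perm u k) ≡ b → b ≤ toℕ (perm w k)
  perm-≤ u w mono zero k eq = z≤n
  perm-≤ u w mono (suc b) k eq = ℕ.≤-<-trans (perm-≤ u w mono b l ul≡b)
    (mono (≡.subst₂ ℕ._<_ (≡.sym ul≡b) (≡.sym eq) ℕ.≤-refl))
    where
    b<n : b ℕ.< n
    b<n = ℕ.<⇒≤ (≡.subst (ℕ._< n) eq (Fin.toℕ<n (perm u k)))
    l = perm (reverse u) (fromℕ< b<n)
    ul≡b : toℕ (perm u l) ≡ b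
    ul≡b = ≡.trans (cong toℕ (perm-reverseˡ u (fromℕ< b<n))) (Fin.toℕ-fromℕ< b<n)

  -- The word s_m ⋯ s_{n-1} s_{m-1} ⋯ s₀

  gen : ℕ → Fin n
  gen k = k mod n

  swap-lower : ∀ {j k p} → toℕ j ≡ suc k → toℕ p ≡ k → toℕ (permGen j p) ≡ suc k
  swap-lower {j} {k} {p} j≡ p≡ = ≡.trans (cong (toℕ ∘ permGen j) p≡prev)
    (≡.trans (cong toℕ (permGen-prev j)) j≡)
    where
    p≡prev : p ≡ prev j
    p≡prev = Fin.toℕ-injective (≡.trans p≡ (≡.sym (toℕ-prev j≡)))

  swap-upper : ∀ {j k p} → toℕ j ≡ suc k → toℕ p ≡ suc k → toℕ (permGen j p) ≡ k
  swap-upper {j} {k} {p} j≡ p≡ = ≡.trans (cong (toℕ ∘ permGen j) p≡j)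
    (≡.trans (cong toℕ (permGen-self j)) (toℕ-prev j≡))
    where
    p≡j : p ≡ j
    p≡j = Fin.toℕ-injective (≡.trans p≡ (≡.sym j≡))

  swap-other : ∀ {j k p} → toℕ j ≡ suc k → toℕ p ≢ k → toℕ p ≢ suc k → permGen j p ≡ p
  swap-other {j} {k} {p} j≡ p≢k p≢1+k = permGen-other j p
    (λ eq → p≢k (≡.trans (cong toℕ eq) (toℕ-prev j≡))) (λ eq → p≢1+k (≡.trans (cong toℕ eq) j≡))

  -- As permutations the two words are cycles: `riseWord (suc b) d` takes b to b + d and lowers b +
  -- 1, ..., b + d by one; `fallWord k` takes k to 0 and raises 0, ..., k - 1 by one.
  riseWord : ℕ → ℕ → Word n
  riseWord a d = map gen (rise a d)

  fallWord : ℕ → Word n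
  fallWord k = map gen (fall k)

  rise-next : ∀ {b d} → suc b ℕ.+ suc d ≡ n → suc (suc b) ℕ.+ d ≡ n
  rise-next {b} {d} eq = ≡.trans (≡.sym (ℕ.+-suc (suc b) d)) eq

  toℕ-gen-rise : ∀ {b d} → suc b ℕ.+ suc d ≡ n → toℕ (gen (suc b)) ≡ suc b
  toℕ-gen-rise {b} {d} eq = toℕ-mod (≡.subst (suc b ℕ.<_) eq (ℕ.m<m+n (suc b) ℕ.z<s))

  rise-below : ∀ b d {p} → suc b ℕ.+ d ≡ n → toℕ p ℕ.< b → perm (riseWord (suc b) d) p ≡ p
  rise-below b zero eq p<b = refl
  rise-below b (suc d) {p} eq p<b = ≡.trans
    (cong (perm (riseWord (suc (suc b)) d))
      (swap-other (toℕ-gen-rise eq) (ℕ.<⇒≢ p<b) (ℕ.<⇒≢ (ℕ.m<n⇒m<1+n p<b))))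
    (rise-below (suc b) d (rise-next eq) (ℕ.m<n⇒m<1+n p<b))

  rise-at : ∀ b d {p} → suc b ℕ.+ d ≡ n → toℕ p ≡ b → toℕ (perm (riseWord (suc b) d) p) ≡ b ℕ.+ d
  rise-at b zero eq p≡b = ≡.trans p≡b (≡.sym (ℕ.+-identityʳ b))
  rise-at b (suc d) eq p≡b = ≡.trans
    (rise-at (suc b) d (rise-next eq) (swap-lower (toℕ-gen-rise eq) p≡b)) (≡.sym (ℕ.+-suc b d))

  rise-above : ∀ b d {p q} → suc b ℕ.+ d ≡ n → toℕ p ≡ suc q → b ≤ q →
    toℕ (perm (riseWord (suc b) d) p) ≡ q
  rise-above b zero {p} eq p≡ b≤q = contradiction (Fin.toℕ<n p)
    (ℕ.≤⇒≯ (≡.subst₂ _≤_ (≡.trans (≡.sym (ℕ.+-identityʳ (suc b))) eq) (≡.sym p≡) (s≤s b≤q)))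
  rise-above b (suc d) {p} {q} eq p≡ b≤q with ℕ.m≤n⇒m<n∨m≡n b≤q
  ... | inj₂ refl = ≡.trans (cong toℕ (rise-below (suc b) d (rise-next eq) (s≤s (ℕ.≤-reflexive swapped))))
                       swapped
    where
    swapped = swap-upper (toℕ-gen-rise eq) p≡
  ... | inj₁ b<q = ≡.trans
    (cong (toℕ ∘ perm (riseWord (suc (suc b)) d)) (swap-other (toℕ-gen-rise eq)
      (λ p≡b → ℕ.<⇒≢ (ℕ.m<n⇒m<1+n b<q) (≡.trans (≡.sym p≡b) p≡))
      (λ p≡1+b → ℕ.<⇒≢ (s≤s b<q) (≡.trans (≡.sym p≡1+b) p≡))))
    (rise-above (suc b) d (rise-next eq) p≡ b<q)

  fall-above : ∀ k {p} → k ℕ.< n → k ℕ.< toℕ p → perm (fallWord k) p ≡ p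
  fall-above zero k<n k<p = refl
  fall-above (suc k) k<n k<p = ≡.trans
    (cong (perm (fallWord k)) (swap-other (toℕ-mod k<n) (ℕ.<⇒≢ (ℕ.<⇒≤ k<p) ∘ ≡.sym) (ℕ.<⇒≢ k<p ∘ ≡.sym)))
    (fall-above k (ℕ.<⇒≤ k<n) (ℕ.<⇒≤ k<p))

  fall-at : ∀ k {p} → k ℕ.< n → toℕ p ≡ k → toℕ (perm (fallWord k) p) ≡ 0
  fall-at zero k<n p≡k = p≡k
  fall-at (suc k) k<n p≡k = fall-at k (ℕ.<⇒≤ k<n) (swap-upper (toℕ-mod k<n) p≡k)

  fall-below : ∀ k {p} → k ℕ.< n → toℕ p ℕ.< k → toℕ (perm (fallWord k) p) ≡ suc (toℕ p)
  fall-below (suc k) {p} k<n (s≤s p≤k) with ℕ.m≤n⇒m<n∨m≡n p≤k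
  ... | inj₁ p<k = ≡.trans
    (cong (toℕ ∘ perm (fallWord k)) (swap-other (toℕ-mod k<n) (ℕ.<⇒≢ p<k) (ℕ.<⇒≢ (ℕ.m<n⇒m<1+n p<k))))
    (fall-below k (ℕ.<⇒≤ k<n) p<k)
  ... | inj₂ refl = ≡.trans
    (cong toℕ (fall-above k (ℕ.<⇒≤ k<n) (ℕ.≤-reflexive (≡.sym swapped)))) swapped
    where
    swapped = swap-lower (toℕ-mod k<n) refl

  rise-letters : ∀ m b d → suc b ℕ.+ d ≡ n → m ℕ.≤ b → All (InIₚ m) (riseWord (suc b) d)
  rise-letters m b zero eq m≤b = []
  rise-letters m b (suc d) eq m≤b =
    ((λ ≡0 → contradiction (≡.trans (≡.sym toℕ≡) ≡0) λ ()) ,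
     (λ ≡m → ℕ.<⇒≢ (s≤s m≤b) (≡.trans (≡.sym ≡m) toℕ≡)))
    ∷ rise-letters m (suc b) d (rise-next eq) (ℕ.m≤n⇒m≤1+n m≤b)
    where toℕ≡ = toℕ-gen-rise eq

  fall-letters : ∀ m k → k ℕ.< n → k ℕ.< m → All (InIₚ m) (fallWord k)
  fall-letters m zero k<n k<m = []
  fall-letters m (suc k) k<n k<m =
    ((λ ≡0 → contradiction (≡.trans (≡.sym toℕ≡) ≡0) λ ()) ,
     (λ ≡m → ℕ.<⇒≢ k<m (≡.trans (≡.sym toℕ≡) ≡m)))
    ∷ fall-letters m k (ℕ.<⇒≤ k<n) (ℕ.<⇒≤ k<m)
    where toℕ≡ = toℕ-mod k<n

  -- The word C for m = b + 1, where b and d count the letters of V below and above m.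

  module Cycle (b d : ℕ) (eq : suc (suc b) ℕ.+ d ≡ n) where

    m : ℕ
    m = suc b

    m<n : m ℕ.< n
    m<n = ≡.subst (m ℕ.<_) eq (ℕ.m≤m+n (suc m) d)

    b<n : b ℕ.< n
    b<n = ℕ.<⇒≤ m<n

    m+d≡last : m ℕ.+ d ≡ toℕ (lastIx {n})
    m+d≡last = ≡.trans (ℕ.suc-injective eq) (≡.sym toℕ-last)

    C V : Word n
    C = cycleWord n m
    V = riseWord (suc m) d ++ fallWord b

    -- The positions m and m + 1 of the paper, the ends of the two blocks that meet.
    a c : Fin n
    c = gen m
    a = prev c

    toℕ-c : toℕ c ≡ m
    toℕ-c = toℕ-mod m<n

    toℕ-a : toℕ a ≡ b
    toℕ-a = toℕ-prev toℕ-c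

    V∈Iₚ : All (InIₚ m) V
    V∈Iₚ = ++⁺ (rise-letters m m d eq ℕ.≤-refl) (fall-letters m b b<n ℕ.≤-refl)

    C-split : C ≡ c ∷ V ++ zero ∷ []
    C-split = begin
      map gen (map (m ℕ.+_) (upTo (n ∸ m)) ++ downFrom m)
        ≡⟨ cong₂ (λ r f → map gen (r ++ f)) rise≡ (downFrom-fall b) ⟩
      map gen (rise m (suc d) ++ fall b ++ 0 ∷ [])
        ≡⟨ map-++ gen (rise m (suc d)) (fall b ++ 0 ∷ []) ⟩
      c ∷ riseWord (suc m) d ++ map gen (fall b ++ 0 ∷ [])
        ≡⟨ cong (λ f → c ∷ riseWord (suc m) d ++ f) (map-++ gen (fall b) (0 ∷ [])) ⟩
      c ∷ riseWord (suc m) d ++ fallWord b ++ zero ∷ []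
        ≡⟨ cong (c ∷_) (++-assoc (riseWord (suc m) d) (fallWord b) (zero ∷ [])) ⟨
      c ∷ V ++ zero ∷ [] ∎
      where
      open ≡.≡-Reasoning
      n∸m≡1+d : n ∸ m ≡ suc d
      n∸m≡1+d = ≡.trans (cong (_∸ m) (≡.trans (≡.sym eq) (≡.sym (ℕ.+-suc m d)))) (ℕ.m+n∸m≡n m (suc d))
      rise≡ : map (m ℕ.+_) (upTo (n ∸ m)) ≡ rise m (suc d)
      rise≡ = ≡.trans (cong (map (m ℕ.+_) ∘ upTo) n∸m≡1+d)
        (≡.trans (map-upTo (m ℕ.+_) (suc d)) (applyUpTo-rise (suc d) (λ _ → refl)))

    perm-V : ∀ p → perm V p ≡ perm (fallWord b) (perm (riseWord (suc m) d) p)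
    perm-V = perm-++ (riseWord (suc m) d) (fallWord b)

    V-below : ∀ {p} → toℕ p ℕ.< b → toℕ (perm V p) ≡ suc (toℕ p)
    V-below {p} p<b = ≡.trans (cong toℕ (≡.trans (perm-V p)
      (cong (perm (fallWord b)) (rise-below m d eq (ℕ.m<n⇒m<1+n p<b))))) (fall-below b b<n p<b)

    V-a : perm V a ≡ zero
    V-a = Fin.toℕ-injective (≡.trans (cong toℕ (≡.trans (perm-V a)
      (cong (perm (fallWord b)) (rise-below m d eq (s≤s (ℕ.≤-reflexive toℕ-a)))))) (fall-at b b<n toℕ-a))

    V-above : ∀ {p q} → toℕ p ≡ suc q → m ≤ q → toℕ (perm V p) ≡ q
    V-above {p} {q} p≡ m≤q = ≡.trans
      (cong toℕ (≡.trans (perm-V p) (fall-above b b<n (≡.subst (b ℕ.<_) (≡.sym r≡q) m≤q)))) r≡q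
      where
      r≡q = rise-above m d eq p≡ m≤q

    V-c : perm V c ≡ lastIx
    V-c = Fin.toℕ-injective (≡.trans (cong toℕ (≡.trans (perm-V c)
        (fall-above b b<n (≡.subst (b ℕ.<_) (≡.sym r≡) (ℕ.m≤m+n m d))))) (≡.trans r≡ m+d≡last))
      where
      r≡ = rise-at m d eq toℕ-c

    -- V carries the pair {a, c} exchanged by s_m to the pair {0, n - 1}
    -- exchanged by s₀, so the two outer letters of C = s_m V s₀ cancel up to a translation.
    perm-C : ∀ p → perm C p ≡ perm V p
    perm-C p = ≡.trans (cong (λ w → perm w p) C-split)
        (≡.trans (perm-++ V (zero ∷ []) (permGen c p)) (go (p Fin.≟ a) (p Fin.≟ c)))
      where
      go : Dec (p ≡ a) → Dec (p ≡ c) → permGen zero (perm V (permGen c p)) ≡ perm V p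
      go (yes refl) _ = ≡.trans (cong (permGen zero) (≡.trans (cong (perm V) (permGen-prev c)) V-c))
        (≡.trans (permGen-prev zero) (≡.sym V-a))
      go (no _) (yes refl) = ≡.trans (cong (permGen zero) (≡.trans (cong (perm V) (permGen-self c)) V-a))
        (≡.trans (permGen-self zero) (≡.sym V-c))
      go (no p≢a) (no p≢c) = ≡.trans (cong (permGen zero ∘ perm V) (permGen-other c p p≢a p≢c))
        (permGen-other zero (perm V p)
          (λ V≡ → p≢c (perm-injective V (≡.trans V≡ (≡.sym V-c))))
          (λ V≡ → p≢a (perm-injective V (≡.trans V≡ (≡.sym V-a)))))

    -- Only the final s₀ translates, by e_1 - e_n. The prefix s_m V takes c to position 0 and a to
    -- position n - 1, and pulling back along it gives the formula.
    shift-C : ∀ p → shift C p ≡ e c p - e a p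
    shift-C p = begin
      shift C p                     ≡⟨ cong (λ w → shift w p) C-split ⟩
      shift (V ++ zero ∷ []) q + shiftGen c p
        ≡⟨ cong₂ _+_ (shift-++ V (zero ∷ []) q)
             (shiftGen-finite c p λ ≡0 → contradiction (≡.trans (≡.sym toℕ-c) ≡0) λ ()) ⟩
      0ℤ + - (1ℤ * (e lastIx (perm V q) - e zero (perm V q))) + shift V q + 0ℤ
        ≡⟨ cong₂ (λ x y → 0ℤ + - (1ℤ * x) + y + 0ℤ) (cong₂ _-_ e-last e-zero) (parabolic-shift V∈Iₚ q) ⟩
      0ℤ + - (1ℤ * (e a p - e c p)) + 0ℤ + 0ℤ
        ≡⟨ lem (e a p) (e c p) ⟩
      e c p - e a p ∎
      where
      open ≡.≡-Reasoning
      q = permGen c p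
      lem : ∀ x y → 0ℤ + - (1ℤ * (x - y)) + 0ℤ + 0ℤ ≡ y - x
      lem = solve-∀
      e-last : e lastIx (perm V q) ≡ e a p
      e-last = ≡.trans (cong (λ l → e l (perm V q)) (≡.sym V-c)) (≡.trans (e-perm V c q)
        (≡.trans (≡.sym (e-permGen c c p)) (cong (λ l → e l p) (permGen-self c))))
      e-zero : e zero (perm V q) ≡ e c p
      e-zero = ≡.trans (cong (λ l → e l (perm V q)) (≡.sym V-a)) (≡.trans (e-perm V a q)
        (≡.trans (≡.sym (e-permGen c a p)) (cong (λ l → e l p) (permGen-prev c))))

    shift-C-a : shift C a ≡ - 1ℤ
    shift-C-a = ≡.trans (shift-C a) (cong₂ _-_ (e-≢ (prev≢ c ∘ ≡.sym)) (e-refl a))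

    shift-C-c : shift C c ≡ 1ℤ
    shift-C-c = ≡.trans (shift-C c) (cong₂ _-_ (e-refl c) (e-≢ (prev≢ c)))

    shift-C-other : ∀ {p} → toℕ p ≢ b → toℕ p ≢ m → shift C p ≡ 0ℤ
    shift-C-other {p} p≢b p≢m = ≡.trans (shift-C p) (cong₂ _-_
      (e-≢ {i = c} λ c≡p → p≢m (≡.trans (cong toℕ (≡.sym c≡p)) toℕ-c))
      (e-≢ {i = a} λ a≡p → p≢b (≡.trans (cong toℕ (≡.sym a≡p)) toℕ-a)))

    C-blocks : PreservesBlocks m C
    C-blocks k = ≡.trans (cong (low m) (perm-C k)) (parabolic-blocks V∈Iₚ k)

    -- V moves a from the end of the lower block to its front and keeps the other positions in
    -- order; the entry -1 of `shift C` at a compensates. Roots landing on e_a - e_j gain one δ.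
    -- Those landing on e_i - e_a lose one, but they had p > 0 because their finite part was
    -- negative.
    V-positive-low : ∀ {i j} → i ≢ j → toℕ i ℕ.< m → toℕ j ℕ.< m → ∀ p →
      PositiveAt (perm V i) (perm V j) p → PositiveAt i j (p - shift C i + shift C j)
    V-positive-low {i} {j} i≢j i<m j<m p pos = go (toℕ i ℕ.≟ b) (toℕ j ℕ.≟ b)
      where
      is-a : ∀ {k} → toℕ k ≡ b → k ≡ a
      is-a k≡b = Fin.toℕ-injective (≡.trans k≡b (≡.sym toℕ-a))
      <b : ∀ {k} → toℕ k ℕ.< m → toℕ k ≢ b → toℕ k ℕ.< b
      <b k<m k≢b = ℕ.≤∧≢⇒< (ℕ.s≤s⁻¹ k<m) k≢b
      shift-0 : ∀ {k} → toℕ k ℕ.< m → toℕ k ≢ b → shift C k ≡ 0ℤ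
      shift-0 k<m k≢b = shift-C-other k≢b (ℕ.<⇒≢ k<m)
      go : Dec (toℕ i ≡ b) → Dec (toℕ j ≡ b) → PositiveAt i j (p - shift C i + shift C j)
      go (yes i≡b) (yes j≡b) = contradiction (≡.trans (is-a i≡b) (≡.sym (is-a j≡b))) i≢j
      go (yes i≡b) (no j≢b) = raise (PositiveAt-≥0 pos) (≡.trans
        (cong₂ (λ x y → p - x + y) (≡.trans (cong (shift C) (is-a i≡b)) shift-C-a) (shift-0 j<m j≢b))
        (lem p))
        where
        lem : ∀ p → p - - 1ℤ + 0ℤ ≡ 1ℤ + p
        lem = solve-∀
      go (no i≢b) (yes j≡b) = lower
        (PositiveAt->
          (≡.subst (ℕ._≤ toℕ (perm V i)) (≡.sym (cong toℕ (≡.trans (cong (perm V) (is-a j≡b)) V-a))) z≤n)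
          pos)
        (≡.trans (cong₂ (λ x y → p - x + y) (shift-0 i<m i≢b) (≡.trans (cong (shift C) (is-a j≡b)) shift-C-a))
          (lem p))
        (≡.subst (toℕ i ℕ.<_) (≡.sym j≡b) (<b i<m i≢b))
        where
        lem : ∀ p → p - 0ℤ + - 1ℤ ≡ p - 1ℤ
        lem = solve-∀
      go (no i≢b) (no j≢b) = PositiveAt-cong
        (λ lt → ℕ.s≤s⁻¹ (≡.subst₂ ℕ._<_ (V-below (<b i<m i≢b)) (V-below (<b j<m j≢b)) lt))
        (≡.trans (cong₂ (λ x y → p - x + y) (shift-0 i<m i≢b) (shift-0 j<m j≢b)) (lem p)) pos
        where
        lem : ∀ p → p - 0ℤ + 0ℤ ≡ p
        lem = solve-∀

    -- The mirror image: c moves from the front of the upper block to its end, and `shift C` is 1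
    -- there.
    V-positive-high : ∀ {i j} → i ≢ j → m ≤ toℕ i → m ≤ toℕ j → ∀ p →
      PositiveAt (perm V i) (perm V j) p → PositiveAt i j (p - shift C i + shift C j)
    V-positive-high {i} {j} i≢j m≤i m≤j p pos = go (toℕ i ℕ.≟ m) (toℕ j ℕ.≟ m)
      where
      is-c : ∀ {k} → toℕ k ≡ m → k ≡ c
      is-c k≡m = Fin.toℕ-injective (≡.trans k≡m (≡.sym toℕ-c))
      m< : ∀ {k} → m ≤ toℕ k → toℕ k ≢ m → m ℕ.< toℕ k
      m< m≤k k≢m = ℕ.≤∧≢⇒< m≤k (k≢m ∘ ≡.sym)
      V-pred : ∀ {k} → m ≤ toℕ k → toℕ k ≢ m → suc (toℕ (perm V k)) ≡ toℕ k
      V-pred {k} m≤k k≢m = pred (toℕ k) refl (m< m≤k k≢m)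
        where
        pred : ∀ l → toℕ k ≡ l → m ℕ.< l → suc (toℕ (perm V k)) ≡ l
        pred (suc l) k≡ (s≤s m≤l) = cong suc (V-above k≡ m≤l)
      shift-0 : ∀ {k} → m ≤ toℕ k → toℕ k ≢ m → shift C k ≡ 0ℤ
      shift-0 m≤k k≢m = shift-C-other (λ k≡b → ℕ.<⇒≱ m≤k (ℕ.≤-reflexive k≡b)) k≢m
      go : Dec (toℕ i ≡ m) → Dec (toℕ j ≡ m) → PositiveAt i j (p - shift C i + shift C j)
      go (yes i≡m) (yes j≡m) = contradiction (≡.trans (is-c i≡m) (≡.sym (is-c j≡m))) i≢j
      go (yes i≡m) (no j≢m) = lower
        (PositiveAt->
          (≡.subst (toℕ (perm V j) ≤_) (cong toℕ (≡.sym (≡.trans (cong (perm V) (is-c i≡m)) V-c)))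
            (≡.subst (toℕ (perm V j) ≤_) (≡.sym toℕ-last) (ℕ.s≤s⁻¹ (Fin.toℕ<n (perm V j)))))
          pos)
        (≡.trans (cong₂ (λ x y → p - x + y) (≡.trans (cong (shift C) (is-c i≡m)) shift-C-c) (shift-0 m≤j j≢m))
          (lem p))
        (≡.subst (ℕ._< toℕ j) (≡.sym i≡m) (m< m≤j j≢m))
        where
        lem : ∀ p → p - 1ℤ + 0ℤ ≡ p - 1ℤ
        lem = solve-∀
      go (no i≢m) (yes j≡m) = raise (PositiveAt-≥0 pos) (≡.trans
        (cong₂ (λ x y → p - x + y) (shift-0 m≤i i≢m) (≡.trans (cong (shift C) (is-c j≡m)) shift-C-c))
        (lem p))
        where
        lem : ∀ p → p - 0ℤ + 1ℤ ≡ 1ℤ + p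
        lem = solve-∀
      go (no i≢m) (no j≢m) = PositiveAt-cong
        (λ lt → ≡.subst₂ ℕ._<_ (V-pred m≤i i≢m) (V-pred m≤j j≢m) (s≤s lt))
        (≡.trans (cong₂ (λ x y → p - x + y) (shift-0 m≤i i≢m) (shift-0 m≤j j≢m)) (lem p)) pos
        where
        lem : ∀ p → p - 0ℤ + 0ℤ ≡ p
        lem = solve-∀

    C-positive : PreservesPositive m C
    C-positive {i} {j} i≢j block p pos = go (const-low {m} {i} {j}
        (≡.trans (≡.sym (C-blocks i)) (≡.trans (low-const {m} block) (C-blocks j))))
      where
      pos′ : PositiveAt (perm V i) (perm V j) p
      pos′ = ≡.subst₂ (λ x y → PositiveAt x y p) (perm-C i) (perm-C j) pos
      go : SameBlock m i j → PositiveAt i j (p - shift C i + shift C j)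
      go (inj₁ (i<m , j<m)) = V-positive-low i≢j i<m j<m p pos′
      go (inj₂ (m≤i , m≤j)) = V-positive-high i≢j m≤i m≤j p pos′

    -- t_ξ is the translation part of the (S̃ₙ)_P-factor of t_{-θ}.
    ξ : Vector ℤ n
    ξ k = (⊝ θ) k - shift C k

    ξ∈Qₚ : InQₚ m ξ
    ξ∈Qₚ = resp (λ k → ≡.sym (≡.trans (cong (λ x → (⊝ θ) k - x) (shift-C k))
                              (lem (e zero k) (e lastIx k) (e a k) (e c k))))
      -- -θ - (e_c - e_a) regroups as (`e a` - `e zero`) + (`e lastIx` - `e c`), one difference for
      -- each block.
      (add (InQₚ-block {i = a} {zero} (inj₁ (≡.subst (ℕ._< m) (≡.sym toℕ-a) ℕ.≤-refl , s≤s z≤n)))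
           (InQₚ-block {i = lastIx} {c} (inj₂
             (≡.subst (m ≤_) m+d≡last (ℕ.m≤m+n m d) , ℕ.≤-reflexive (≡.sym toℕ-c)))))
      where
      lem : ∀ z l a c → - (z - l) - (c - a) ≡ a - z + (l - c)
      lem = solve-∀

    -- On each block the shift of w is weakly decreasing, takes at most two
    -- consecutive values, and has the same sum as the shift of C.
    shift-unique : ∀ w → PreservesPositive m w → PreservesBlocks m w →
      InQₚ m (shift w ⊖ shift C) → shift w ≗ shift C
    shift-unique w pos blocks y-τ∈Q k = go (low m k) refl
      where
      y τ : Vector ℤ n
      y = shift w
      τ = shift C
      -- With p = 1 the test root is positive in whichever order `perm w i` and `perm w j` stand, so
      -- the bounds on y do not depend on `perm w`.
      moved : ∀ {i j} → i ≢ j → low m i ≡ low m j → PositiveAt i j (1ℤ - y i + y j)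
      moved {i} {j} i≢j same = pos i≢j (const-low (≡.trans (blocks i) (≡.trans same (≡.sym (blocks j)))))
                                  1ℤ (inj₁ (ℤ.+<+ (s≤s z≤n)))
      -- The image e_j - e_i with i < j is a negative finite root, so its δ-coefficient must be
      -- strictly positive; for the opposite sign, `narrow` obtains only a nonnegative one.
      decreasing : ∀ {i j} → low m i ≡ low m j → i Fin.< j → y j ℤ.≤ y i
      decreasing {i} {j} same i<j = ℤ.0≤i-j⇒j≤i (≡.subst (0ℤ ℤ.≤_) (lem (y i) (y j))
          (ℤ.i<j⇒i≤pred[j] (PositiveAt-> (ℕ.<⇒≤ i<j) (moved (ℕ.<⇒≢ i<j ∘ ≡.sym ∘ cong toℕ) (≡.sym same)))))
        where
        lem : ∀ a b → - 1ℤ + (1ℤ - b + a) ≡ a - b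
        lem = solve-∀
      narrow : ∀ {i j} → low m i ≡ low m j → i Fin.< j → y i ℤ.≤ 1ℤ + y j
      narrow {i} {j} same i<j = ℤ.0≤i-j⇒j≤i (≡.subst (0ℤ ℤ.≤_) (lem (y i) (y j))
          (PositiveAt-≥0 (moved (ℕ.<⇒≢ i<j ∘ cong toℕ) same)))
        where
        lem : ∀ a b → 1ℤ - a + b ≡ 1ℤ + b - a
        lem = solve-∀
      ≥⇒≡ : ∀ B → (∀ k → low m k ≡ B → τ k ℤ.≤ y k) → ∀ k → low m k ≡ B → y k ≡ τ k
      ≥⇒≡ B y≥τ k k∈B = ℤ.i-j≡0⇒i≡j (y k) (τ k)
        (InQₚ-nonneg⇒0 B y-τ∈Q (λ l l∈B → ℤ.i≤j⇒0≤j-i (y≥τ l l∈B)) k k∈B)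
      ≤⇒≡ : ∀ B → (∀ k → low m k ≡ B → y k ℤ.≤ τ k) → ∀ k → low m k ≡ B → y k ≡ τ k
      ≤⇒≡ B y≤τ k k∈B = ≡.sym (ℤ.i-j≡0⇒i≡j (τ k) (y k)
        (InQₚ-nonneg⇒0 B (resp (λ l → lem (y l) (τ l)) (neg y-τ∈Q))
          (λ l l∈B → ℤ.i≤j⇒0≤j-i (y≤τ l l∈B)) k k∈B))
        where
        lem : ∀ a b → - (a - b) ≡ b - a
        lem = solve-∀
      low-a : low m a ≡ true
      low-a = low-true a (s≤s (ℕ.≤-reflexive toℕ-a))
      low-c : low m c ≡ false
      low-c = low-false c (ℕ.≤-reflexive (≡.sym toℕ-c))
      low-cases : ∀ k → low m k ≡ true → k ≡ a ⊎ (k Fin.< a × τ k ≡ 0ℤ)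
      low-cases k k∈ with ℕ.m≤n⇒m<n∨m≡n (ℕ.s≤s⁻¹ (true-low {m} k k∈))
      ... | inj₂ k≡b = inj₁ (Fin.toℕ-injective (≡.trans k≡b (≡.sym toℕ-a)))
      ... | inj₁ k<b = inj₂ (≡.subst (toℕ k ℕ.<_) (≡.sym toℕ-a) k<b ,
                             shift-C-other (ℕ.<⇒≢ k<b) (ℕ.<⇒≢ (ℕ.m<n⇒m<1+n k<b)))
      high-cases : ∀ k → low m k ≡ false → k ≡ c ⊎ (c Fin.< k × τ k ≡ 0ℤ)
      high-cases k k∈ with ℕ.m≤n⇒m<n∨m≡n (false-low {m} k k∈)
      ... | inj₂ m≡k = inj₁ (Fin.toℕ-injective (≡.trans (≡.sym m≡k) (≡.sym toℕ-c)))
      ... | inj₁ m<k = inj₂ (≡.subst (ℕ._< toℕ k) (≡.sym toℕ-c) m<k ,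
                             shift-C-other (ℕ.<⇒≢ (ℕ.<⇒≤ m<k) ∘ ≡.sym) (ℕ.<⇒≢ m<k ∘ ≡.sym))
      -- If y a ≥ 0, then y ≥ 0 on the lower block, because a is its last position. Hence y ≥ τ
      -- there, and the zero block sum of y - τ forces y a = τ a = -1, a contradiction. The bound on
      -- y c is dual.
      y-a≤-1 : y a ℤ.≤ - 1ℤ
      y-a≤-1 with 0ℤ ℤ.≤? y a
      ... | no 0≰ya = ℤ.i<j⇒i≤pred[j] (ℤ.≰⇒> 0≰ya)
      ... | yes 0≤ya = contradiction
        (≡.subst (0ℤ ℤ.≤_) (≡.trans (≥⇒≡ true bound a low-a) shift-C-a) 0≤ya) λ ()
        where
        bound : ∀ k → low m k ≡ true → τ k ℤ.≤ y k
        bound k k∈ with low-cases k k∈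
        ... | inj₁ refl = ℤ.≤-trans (ℤ.≤-trans (ℤ.≤-reflexive shift-C-a) ℤ.-≤+) 0≤ya
        ... | inj₂ (k<a , τk≡0) = ℤ.≤-trans (ℤ.≤-trans (ℤ.≤-reflexive τk≡0) 0≤ya)
                                            (decreasing (≡.trans k∈ (≡.sym low-a)) k<a)
      1≤y-c : 1ℤ ℤ.≤ y c
      1≤y-c with y c ℤ.≤? 0ℤ
      ... | no yc≰0 = ℤ.i<j⇒suc[i]≤j (ℤ.≰⇒> yc≰0)
      ... | yes yc≤0 = contradiction
        (≡.subst (ℤ._≤ 0ℤ) (≡.trans (≤⇒≡ false bound c low-c) shift-C-c) yc≤0)
        λ { (ℤ.+≤+ ()) }
        where
        bound : ∀ k → low m k ≡ false → y k ℤ.≤ τ k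
        bound k k∈ with high-cases k k∈
        ... | inj₁ refl = ℤ.≤-trans yc≤0 (ℤ.≤-trans (ℤ.+≤+ z≤n) (ℤ.≤-reflexive (≡.sym shift-C-c)))
        ... | inj₂ (c<k , τk≡0) = ℤ.≤-trans (decreasing (≡.trans low-c (≡.sym k∈)) c<k)
                                            (ℤ.≤-trans yc≤0 (ℤ.≤-reflexive (≡.sym τk≡0)))
      go : ∀ B → low m k ≡ B → y k ≡ τ k
      -- From y a ≤ -1, `narrow` caps the other entries of the lower block at 0, so y ≤ τ there. On
      -- the upper block, 1 ≤ y c likewise keeps the others nonnegative.
      go true k∈ = ≤⇒≡ true bound k k∈
        where
        bound : ∀ k → low m k ≡ true → y k ℤ.≤ τ k
        bound k k∈ with low-cases k k∈
        ... | inj₁ refl = ℤ.≤-trans y-a≤-1 (ℤ.≤-reflexive (≡.sym shift-C-a))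
        ... | inj₂ (k<a , τk≡0) = ℤ.≤-trans (narrow (≡.trans k∈ (≡.sym low-a)) k<a)
          (ℤ.≤-trans (ℤ.+-monoʳ-≤ 1ℤ y-a≤-1) (ℤ.≤-reflexive (≡.sym τk≡0)))
      go false k∈ = ≥⇒≡ false bound k k∈
        where
        lem : ∀ x → 1ℤ + x - 1ℤ ≡ x - 0ℤ
        lem = solve-∀
        bound : ∀ k → low m k ≡ false → τ k ℤ.≤ y k
        bound k k∈ with high-cases k k∈
        ... | inj₁ refl = ℤ.≤-trans (ℤ.≤-reflexive shift-C-c) 1≤y-c
        ... | inj₂ (c<k , τk≡0) = ℤ.≤-trans (ℤ.≤-reflexive τk≡0)
          (ℤ.0≤i-j⇒j≤i (≡.subst (0ℤ ℤ.≤_) (lem (y k))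
            (ℤ.i≤j⇒0≤j-i (ℤ.≤-trans 1≤y-c (narrow (≡.trans low-c (≡.sym k∈)) c<k)))))

    minimal-unique : ∀ w → PreservesPositive m w → PreservesBlocks m w →
      InQₚ m (shift w ⊖ shift C) → w ≈ C
    minimal-unique w pos blocks diff∈Q = faithful w C
        (λ k → Fin.toℕ-injective (ℕ.≤-antisym
          (perm-≤ w C (perm-order w C pos C-positive blocks C-blocks shift≡) _ k refl)
          (perm-≤ C w (perm-order C w C-positive pos C-blocks blocks (≡.sym ∘ shift≡)) _ k refl)))
        shift≡
      where
      shift≡ : shift w ≗ shift C
      shift≡ = shift-unique w pos blocks diff∈Q

    -- The factorization of the translation by -θ and its uniqueness.

    module _ {c ℓ} (K : CommutativeRing c ℓ) (char0 : CharacteristicZero K)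
             (t : Word n) (t-translation : IsTranslation K (⊝ θ) t) where

      open Scalars K

      t-perm : ∀ k → perm t k ≡ k
      t-perm = translation-perm char0 (⊝ θ) t t-translation

      t-shift : ∀ k → shift t k ≡ (⊝ θ) k
      t-shift = translation-shift char0 (⊝ θ) t t-translation

      -- The solution of t = C V⁻¹ t′. Its permutation is trivial because `perm C` and `perm V`
      -- agree, so it is a translation.
      t′ : Word n
      t′ = V ++ reverse C ++ t

      t≈ : t ≈ C ++ (reverse V ++ t′)
      t≈ = begin
        t                                             ≈⟨ cancel-reverse C t ⟨
        C ++ (reverse C ++ t)                         ≈⟨ ++-cong (refl {u = C}) cancel-V ⟨
        C ++ (reverse V ++ (V ++ (reverse C ++ t)))   ∎
        where
        open ≈-Reasoning
        cancel-V : reverse V ++ (V ++ (reverse C ++ t)) ≈ reverse C ++ t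
        cancel-V = ≡.subst (λ u → reverse V ++ (u ++ (reverse C ++ t)) ≈ reverse C ++ t) (reverse-involutive V)
          (cancel-reverse (reverse V) (reverse C ++ t))

      t′-translation : IsTranslation K ξ t′
      t′-translation = isTranslation {w = t′} perm-t′ shift-t′
        where
        back : ∀ k → perm (reverse C) (perm V k) ≡ k
        back k = ≡.trans (cong (perm (reverse C)) (≡.sym (perm-C k))) (perm-reverseʳ C k)
        perm-t′ : ∀ k → perm t′ k ≡ k
        perm-t′ k = ≡.trans (perm-++ V (reverse C ++ t) k)
          (≡.trans (perm-++ (reverse C) t (perm V k)) (≡.trans (t-perm _) (back k)))
        shift-reverse-C : ∀ k → shift (reverse C) (perm V k) ≡ - shift C k
        shift-reverse-C k = ≡.trans (lem (shift (reverse C) (perm V k)) (shift C k))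
          (≡.trans (cong (_- shift C k)
            (≡.trans (cong (λ l → shift (reverse C) l + shift C k) (≡.sym (perm-C k)))
              (≡.trans (≡.sym (shift-++ C (reverse C) k)) (shift-≈ (reverse-inverseʳ C) k))))
            (ℤ.+-identityˡ _))
          where
          lem : ∀ x y → x ≡ x + y - y
          lem = solve-∀
        shift-t′ : shift t′ ≗ ξ
        shift-t′ k = begin
          shift t′ k
            ≡⟨ shift-++ V (reverse C ++ t) k ⟩
          shift (reverse C ++ t) (perm V k) + shift V k
            ≡⟨ cong₂ _+_ (shift-++ (reverse C) t (perm V k)) (parabolic-shift V∈Iₚ k) ⟩
          shift t (perm (reverse C) (perm V k)) + shift (reverse C) (perm V k) + 0ℤ
            ≡⟨ ℤ.+-identityʳ _ ⟩
          shift t (perm (reverse C) (perm V k)) + shift (reverse C) (perm V k)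
            ≡⟨ cong₂ _+_ (≡.trans (cong (shift t) (back k)) (t-shift k)) (shift-reverse-C k) ⟩
          ξ k ∎
          where open ≡.≡-Reasoning

      factorization : IsFactorization K m t C (reverse V ++ t′)
      factorization = preserves⇒S̃ᴾ C C-positive ,
        (reverse V , ξ , t′ , reverse⁺ V∈Iₚ , ξ∈Qₚ , t′-translation , refl) , t≈

      -- Since t and s permute nothing, `perm u₁` is inverse to `perm v` and preserves the blocks.
      -- Since v shifts nothing, `shift u₁` is -θ - x, which differs from `shift C` by ξ - x in Q_P.
      factor-unique : ∀ u₁ u₂ → IsFactorization K m t u₁ u₂ → u₁ ≈ C
      factor-unique u₁ u₂ (u₁∈ , (v , x , s , v∈ , x∈Q , s-translation , u₂≈) , t≈u₁u₂) =
        minimal-unique u₁ (S̃ᴾ⇒preserves u₁ u₁∈) blocks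
          (resp (λ k → ≡.sym (≡.trans (cong (_- shift C k) (shift-u₁ k)) (lem ((⊝ θ) k) (x k) (shift C k))))
                (add ξ∈Qₚ (neg x∈Q)))
        where
        lem : ∀ z x τ → z - x - τ ≡ z - τ + - x
        lem = solve-∀
        t≈′ : t ≈ u₁ ++ (v ++ s)
        t≈′ = trans t≈u₁u₂ (++-cong (refl {u = u₁}) u₂≈)
        v-u₁ : ∀ k → perm v (perm u₁ k) ≡ k
        v-u₁ k = ≡.trans (≡.sym (translation-perm char0 x s s-translation _))
          (≡.trans (≡.sym (≡.trans (perm-++ u₁ (v ++ s) k) (perm-++ v s (perm u₁ k))))
            (≡.trans (≡.sym (perm-≈ t≈′ k)) (t-perm k)))
        blocks : PreservesBlocks m u₁
        blocks k = ≡.trans (≡.sym (parabolic-blocks v∈ (perm u₁ k))) (cong (low m) (v-u₁ k))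
        shift-u₁ : ∀ k → shift u₁ k ≡ (⊝ θ) k - x k
        shift-u₁ k = begin
          shift u₁ k ≡⟨ lem′ (x k) (shift u₁ k) ⟩
          x k + 0ℤ + shift u₁ k - x k
            ≡⟨ cong₂ (λ p q → p + q + shift u₁ k - x k)
                 (≡.trans (cong (shift s) (v-u₁ k)) (translation-shift char0 x s s-translation k))
                 (parabolic-shift v∈ (perm u₁ k)) ⟨
          shift s (perm v (perm u₁ k)) + shift v (perm u₁ k) + shift u₁ k - x k
            ≡⟨ cong (λ p → p + shift u₁ k - x k) (shift-++ v s (perm u₁ k)) ⟨
          shift (v ++ s) (perm u₁ k) + shift u₁ k - x k
            ≡⟨ cong (_- x k) (shift-++ u₁ (v ++ s) k) ⟨
          shift (u₁ ++ (v ++ s)) k - x k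
            ≡⟨ cong (_- x k) (≡.trans (≡.sym (shift-≈ t≈′ k)) (t-shift k)) ⟩
          (⊝ θ) k - x k ∎
          where
          open ≡.≡-Reasoning
          lem′ : ∀ x y → y ≡ x + 0ℤ + y - x
          lem′ = solve-∀

proposition3p9 : ∀ {c ℓ} (K : CommutativeRing c ℓ) → CharacteristicZero K →
    (n m : ℕ) .{{_ : NonZero n}} → 3 ≤ n → 1 ≤ m → m ≤ n ∸ 1 →
    (t : Word n) → IsTranslation K (⊝ θ) t →
    Isπₚ K m t (cycleWord n m)
proposition3p9 K char0 (suc (suc (suc n′))) (suc b) (s≤s (s≤s (s≤s z≤n))) (s≤s z≤n) m≤n-1 t t-translation =
    (_ , factorization K char0 t t-translation) , factor-unique K char0 t t-translation
  where
  open Affine n′ using (module Cycle)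
  -- The letters above m are m + 1, ..., n - 1, so d = n - 1 - m.
  open Cycle b (suc (suc n′) ∸ suc b) (cong suc (ℕ.m+[n∸m]≡n m≤n-1)) using (factorization; factor-unique)
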